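{- Let $M$ be a matroid on a finite ground set $E$ with rank function $r$, and let $k>0$ be an integer. Let $\mathcal F_k=\{\sigma\subseteq\vec U:\sigma\text{ is a star with }\|\sigma\|<k\}$, where for a star $\sigma=\{(A_i,B_i):i=0,\dots,n\}$, $\|\sigma\|=\sum_{i=0}^nr(B_i)-n\,r(M)$. The following are equivalent: (i) $M$ has tree-width at least $k$; (ii) $M$ has no $S_k$-tree over $\mathcal F_k$; (iii) $M$ has an $\mathcal F_k$-tangle of $S_k$.
   Context: $\lambda(X)=r(X)+r(E\setminus X)-r(M)$. $\vec U$ is the set of all bipartitions $(X,Y)$ of $E$ (parts possibly empty), with $(A,B)\le(C,D)$ iff $A\subseteq C,B\supseteq D$, inverse $(B,A)$. $\vec S_k=\{(X,Y)\in\vec U:\lambda(X)<k\}$ and $S_k$ its set of unoriented separations $\{X,Y\}$. For oriented $\vec s$, $\overleftarrow s$ is its inverse. A star is a nonempty set $\sigma$ of oriented separations with $\vec r\le\overleftarrow s$ for all distinct $\vec r,\vec s\in\sigma$. An $\mathcal F_k$-tangle of $S_k$ is a subset $O\subseteq\vec S_k$ containing exactly one of $(X,Y),(Y,X)$ for each $\{X,Y\}\in S_k$, which is consistent (no distinct $r,s$ with orientations $\vec r<\vec s$ and $\overleftarrow r,\vec s\in O$) and has no subset in $\mathcal F_k$. An $S_k$-tree over $\mathcal F_k$ is a pair $(T,\alpha)$ of a tree $T$ with at least one edge and a map $\alpha$ from ordered pairs $(x,y)$ with $xy\in E(T)$ to $\vec S_k$ such that $\alpha(y,x)$ is the inverse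 of $\alpha(x,y)$ and $\{\alpha(x,t):xt\in E(T)\}\in\mathcal F_k$ for every node $t$. A tree-decomposition of $M$ is a pair $(T,\tau)$ of a tree $T$ and a map $\tau:E\to V(T)$. For a node $t$ with $T_1,\dots,T_d$ the components of $T-t$ and $F_i=\tau^{ -1}(V(T_i))$, the width of $t$ is $\sum_{i=1}^dr(E\setminus F_i)-(d-1)r(M)$ (and is $r(M)$ if $t$ is the only node). The width of $(T,\tau)$ is the maximum width of its nodes, and the tree-width of $M$ is the minimum width of a tree-decomposition of $M$. -}

module Defs where

open import Level using (0ℓ)
open import Data.Bool using (Bool; true; false; T; not; _∧_; _∨_)
open import Data.Nat as ℕ using (ℕ; zero; suc; _∸_; _≤_)
open import Data.Integer as ℤ using (ℤ; +_)
open import Data.Fin using (Fin; _≟_)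
open import Data.Fin.Subset using (Subset; _⊆_; ∁; _∩_; _∪_; ∣_∣; ⊤)
open import Data.Vec using (tabulate)
open import Data.List using (List; []; _∷_; _++_; length; map; filterᵇ; allFin)
open import Data.Nat.ListAction using (sum)
open import Data.Bool.ListAction using (any)
open import Data.Empty using (⊥)
open import Data.List.Membership.Propositional using (_∈_)
open import Data.List.Relation.Unary.All using (All)
open import Data.List.Relation.Unary.Linked using (Linked)
open import Data.List.Relation.Unary.Unique.Propositional using (Unique)
open import Data.Product using (Σ; ∃; _×_; _,_)
open import Data.Sum using (_⊎_)
open import Relation.Nullary using (¬_; ⌊_⌋)
open import Relation.Unary using (Pred)
open import Relation.Binary.PropositionalEquality using (_≡_; _≢_)
open import Function.Bundles using (_⇔_)

record Matroid (n : ℕ) : Set where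
  field
    r          : Subset n → ℕ
    r-bounded  : ∀ X → r X ≤ ∣ X ∣
    r-mono     : ∀ {X Y} → X ⊆ Y → r X ≤ r Y
    r-submod   : ∀ X Y → r (X ∪ Y) ℕ.+ r (X ∩ Y) ≤ r X ℕ.+ r Y

module _ {n : ℕ} (M : Matroid n) where
  open Matroid M

  rM : ℕ
  rM = r ⊤

  conn : Subset n → ℤ
  conn X = + (r X ℕ.+ r (∁ X)) ℤ.- + rM

-- Oriented separations: a bipartition (X , Y) of E is encoded by its
-- first part X; its second part is Y = E ∖ X.

Sep : ℕ → Set
Sep n = Subset n

fstS : ∀ {n} → Sep n → Subset n
fstS X = X

sndS : ∀ {n} → Sep n → Subset n
sndS X = ∁ X

inv : ∀ {n} → Sep n → Sep n
inv X = ∁ X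

_≤S_ : ∀ {n} → Sep n → Sep n → Set
a ≤S c = (fstS a ⊆ fstS c) × (sndS c ⊆ sndS a)

_<S_ : ∀ {n} → Sep n → Sep n → Set
a <S c = (a ≤S c) × (a ≢ c)

module _ {n : ℕ} (M : Matroid n) (k : ℕ) where
  open Matroid M

  InSk : Sep n → Set
  InSk X = conn M X ℤ.< + k

  -- A finite set of oriented separations is represented by a duplicate-free
  -- list of its elements.

  IsStar : List (Sep n) → Set
  IsStar σ = (σ ≢ []) × (∀ a b → a ∈ σ → b ∈ σ → a ≢ b → a ≤S inv b)

  norm : List (Sep n) → ℤ
  norm σ = + sum (map (λ a → r (sndS a)) σ) ℤ.- (+ (length σ ∸ 1) ℤ.* + rM M)

  InF : List (Sep n) → Set
  InF σ = Unique σ × IsStar σ × (norm σ ℤ.< + k)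

  IsTangle : Pred (Sep n) 0ℓ → Set
  IsTangle O =
      (∀ X → O X → InSk X)
    × (∀ X → InSk X → (O X ⊎ O (inv X)) × (O X → O (inv X) → X ≡ inv X))
      -- consistency: no distinct r, s with orientations r⃗ < s⃗, r⃖ ∈ O, s⃗ ∈ O
    × (∀ a c → a ≢ c → a ≢ inv c → a <S c → O (inv a) → O c → ⊥)
    × (∀ σ → All O σ → ¬ InF σ)

  HasTangle : Set₁
  HasTangle = Σ (Pred (Sep n) 0ℓ) IsTangle

data Walk {m : ℕ} (adj : Fin m → Fin m → Bool) : Fin m → Fin m → Set where
  here : ∀ {x} → Walk adj x x
  step : ∀ {x y z} → T (adj x y) → Walk adj y z → Walk adj x z

HasCycle : ∀ {m} → (Fin m → Fin m → Bool) → Set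
HasCycle {m} adj =
  Σ (Fin m) λ x → Σ (List (Fin m)) λ xs →
    (2 ≤ length xs) × Unique (x ∷ xs) ×
    Linked (λ u v → T (adj u v)) (x ∷ xs ++ x ∷ [])

record Tree : Set where
  field
    nodes     : ℕ
    nonempty  : 1 ≤ nodes
    adj       : Fin nodes → Fin nodes → Bool
    adj-sym   : ∀ x y → adj x y ≡ adj y x
    adj-irr   : ∀ x → adj x x ≡ false
    connected : ∀ x y → Walk adj x y
    acyclic   : ¬ HasCycle adj

module _ (Tr : Tree) where
  open Tree Tr

  reachAvoid : Fin nodes → ℕ → Fin nodes → Fin nodes → Bool
  reachAvoid t zero x y = ⌊ x ≟ y ⌋
  reachAvoid t (suc j) x y =
    reachAvoid t j x y ∨
    any (λ z → reachAvoid t j x z ∧ adj z y ∧ not ⌊ y ≟ t ⌋) (allFin nodes)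

  -- y lies in the component of T − t containing x (x ≠ t)
  sameComp : Fin nodes → Fin nodes → Fin nodes → Bool
  sameComp t x y = reachAvoid t nodes x y

  -- neighbours of t; they lie in distinct components of T − t, and every
  -- component of T − t contains exactly one of them
  neighbours : Fin nodes → List (Fin nodes)
  neighbours t = filterᵇ (adj t) (allFin nodes)

  HasEdge : Set
  HasEdge = Σ (Fin nodes) λ x → Σ (Fin nodes) λ y → T (adj x y)

record TreeDec (n : ℕ) : Set where
  field
    tree : Tree
    τ    : Fin n → Fin (Tree.nodes tree)

module _ {n : ℕ} (M : Matroid n) where
  open Matroid M

  nodeWidth : (D : TreeDec n) → Fin (Tree.nodes (TreeDec.tree D)) → ℤ
  nodeWidth D t with neighbours tree t
    where open TreeDec D
  ... | [] = + rM M
  ... | ns@(_ ∷ _) =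
        + sum (map (λ x → r (∁ (F x))) ns) ℤ.- (+ (length ns ∸ 1) ℤ.* + rM M)
    where
      open TreeDec D
      F : Fin (Tree.nodes tree) → Subset n
      F x = tabulate (λ e → sameComp tree t x (τ e))

  TreeWidthAtLeast : ℕ → Set
  TreeWidthAtLeast k = ∀ (D : TreeDec n) →
    Σ (Fin (Tree.nodes (TreeDec.tree D))) λ t → + k ℤ.≤ nodeWidth D t

record SkTree {n : ℕ} (M : Matroid n) (k : ℕ) : Set where
  field
    tree    : Tree
  open Tree tree
  field
    hasEdge : HasEdge tree
    α       : (x y : Fin nodes) → T (adj x y) → Sep n
    α-Sk    : ∀ x y p → InSk M k (α x y p)
    α-inv   : ∀ x y (p : T (adj x y)) (q : T (adj y x)) → α y x q ≡ inv (α x y p)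
    α-star  : ∀ t → Σ (List (Sep n)) λ σ →
                InF M k σ ×
                (∀ s → s ∈ σ ⇔ Σ (Fin nodes) λ x → Σ (T (adj x t)) λ p → α x t p ≡ s)

HasSkTree : ∀ {n} → Matroid n → ℕ → Set
HasSkTree M k = SkTree M k

{-# OPTIONS --safe #-}
module Submission where

-- The circle is: large tree-width ⇒ tangle ⇒ no S_k-tree ⇒ large tree-width.
--
-- Say that X is a branch relative to a list Q of separations if some rooted tree of low-norm stars,
-- with leaves in Q or empty, displays X at its root edge; Q has a conflict if both X and its complement
-- are branches. Starting with the empty Q, we keep adding an inclusion-minimal unoriented Y, which keeps
-- Q closed under smaller separations. If Q + Y leads to a conflict, rerooting the offending tree at a leaf Y
-- shows that ∁ Y is a branch relative to Q already. The same holds for a minimal unoriented Y′ ⊆ ∁ Y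
-- unless we are done, and then the two branches ∁ Y and ∁ Y′ can both be shifted, without increasing norms,
-- to a Z of least connectivity with Y′ ⊆ Z ⊆ ∁ Y: a conflict relative to Q. So either every separation can
-- be oriented, giving a tangle, or there is a conflict relative to the empty list, which is a tree of
-- low-norm stars and hence a tree-decomposition of small width.
--
-- A tangle orients the edges of an S_k-tree so that every node has an outgoing edge, which is impossible
-- in a finite tree. A tree-decomposition of small width becomes an S_k-tree by labelling the edge xt with
-- the elements living in the component of x in T − t.

open import Defs
open import Data.Nat using (ℕ; zero; suc; _+_; _*_; _∸_; _≤_; _<_; z≤n; s≤s; _<?_)
open import Data.Nat.Properties hiding (_≟_)
open import Data.Nat.ListAction using (sum)
open import Data.Nat.ListAction.Properties using (sum-↭)
open import Data.Nat.Tactic.RingSolver using (solve-∀)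
open import Data.Integer as ℤ using (ℤ; +_; +<+)
import Data.Integer.Properties as ℤₚ
open import Data.Bool using (Bool; false; T)
import Data.Bool.Properties as Boolₚ
open import Data.Fin using (Fin; zero; suc; _≟_; toℕ; fromℕ<)
import Data.Fin.Properties as Finₚ
open import Data.Fin.Subset using (Subset; _⊆_; ∁; _∩_; _∪_; ∣_∣; inside; outside)
  renaming (⊤ to full; ⊥ to ∅; _∈_ to _∈ˢ_; _∉_ to _∉ˢ_)
open import Data.Fin.Subset.Properties
  using (⊆-antisym; ⊆-refl; ⊆-trans; _⊆?_; anySubset?; x∈p⇒x∉∁p; x∈∁p⇒x∉p; x∉∁p⇒x∈p; x∉p⇒x∈∁p;
         p⊆q⇒∁p⊇∁q; p∩q⊆p; p∩q⊆q; x∈p∩q⁺; x∈p∩q⁻; q⊆p∪q; x∈p∪q⁻; x∈p∪q⁺; ∉⊥; ∣⊥∣≡0; ∈⊤; ⊆⊤; p⊂q⇒∣p∣<∣q∣)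
  renaming (_∈?_ to _∈ˢ?_)
open import Data.Vec using ([]; _∷_; tabulate)
open import Data.Vec.Properties using (≡-dec; lookup⇒[]=; []=⇒lookup; lookup∘tabulate)
open import Data.List using (List; []; _∷_; [_]; _++_; length; map; allFin)
open import Data.List.Properties using (length-map; length-tabulate; map-∘; map-cong-local; ++-identityʳ)
open import Data.List.Membership.Propositional using (_∈_; _∉_; lose)
open import Data.List.Membership.Propositional.Properties
  using (∈-∃++; ∈-map⁺; ∈-map⁻; ∈-++⁺ˡ; ∈-++⁺ʳ; ∈-allFin; ∈-filter⁺; ∈-filter⁻)
open import Data.List.Membership.Propositional.Properties.WithK using (unique∧set⇒bag)
import Data.List.Membership.DecPropositional as DecMembership
open import Data.List.Relation.Binary.BagAndSetEquality using (∼bag⇒↭)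
open import Data.List.Relation.Binary.Permutation.Propositional
  using (_↭_; ↭-refl; ↭-sym; ↭-trans; ↭-reflexive; prep; swap; ↭⇒↭ₛ)
open import Data.List.Relation.Binary.Permutation.Propositional.Properties
  using (↭-length; shift; map⁺; ∈-resp-↭; ++⁺ˡ; ++-comm)
import Data.List.Relation.Binary.Permutation.Setoid.Properties as SetoidPerm
open import Data.List.Relation.Unary.All as All using (All; []; _∷_)
open import Data.List.Relation.Unary.All.Properties using (++⁺; ++⁻ˡ; ¬Any⇒All¬)
open import Data.List.Relation.Unary.AllPairs using (AllPairs; []; _∷_; allPairs?)
import Data.List.Relation.Unary.AllPairs.Properties as AllPairsₚ
open import Data.List.Relation.Unary.Any using (here; there; satisfied)
open import Data.List.Relation.Unary.Any.Properties using (any⁺; any⁻)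
open import Data.List.Relation.Unary.Linked using (Linked; [-]; _∷_)
open import Data.List.Relation.Unary.Unique.Propositional using (Unique)
import Data.List.Relation.Unary.Unique.Propositional.Properties as Uniqueₚ
open import Data.Product using (Σ; ∃; ∃-syntax; _×_; _,_; proj₁; proj₂)
open import Data.Sum using (_⊎_; inj₁; inj₂; [_,_]′)
open import Data.Empty using (⊥; ⊥-elim)
open import Function using (_∘_; id; _⇔_; mk⇔; Equivalence)
open import Relation.Binary.Construct.Closure.ReflexiveTransitive
  using (Star; ε; _◅_; _◅◅_) renaming (map to Star-map)
open import Relation.Binary.PropositionalEquality
  using (_≡_; _≢_; refl; sym; trans; cong; subst; setoid; resp₂)
open import Relation.Nullary using (¬_; Dec; yes; no; contradiction; ¬?; _×-dec_; ⌊_⌋)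
open import Relation.Nullary.Decidable using (map′; toWitness; fromWitness; toWitnessFalse; fromWitnessFalse)

-- Counting and finite search over subsets.

Unique-length : ∀ {A : Set} {xs ys : List A} → Unique xs → (∀ {x} → x ∈ xs → x ∈ ys) → length xs ≤ length ys
Unique-length {xs = []} _ _ = z≤n
Unique-length {xs = x ∷ xs} (x∉xs ∷ uniq) sub with ∈-∃++ (sub (here refl))
... | ps , qs , refl = begin
  suc (length xs)          ≤⟨ s≤s (Unique-length uniq sub′) ⟩
  suc (length (ps ++ qs))  ≡⟨ ↭-length (↭-sym (shift x ps qs)) ⟩
  length (ps ++ x ∷ qs)    ∎
  where
  open ≤-Reasoning
  sub′ : ∀ {y} → y ∈ xs → y ∈ ps ++ qs
  sub′ y∈xs with ∈-resp-↭ (shift x ps qs) (sub (there y∈xs))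
  ... | here refl = contradiction refl (All.lookup x∉xs y∈xs)
  ... | there y∈ = y∈

subsets : ∀ n → List (Subset n)
subsets zero = [] ∷ []
subsets (suc n) = map (inside ∷_) (subsets n) ++ map (outside ∷_) (subsets n)

∈-subsets : ∀ {n} (X : Subset n) → X ∈ subsets n
∈-subsets [] = here refl
∈-subsets (inside ∷ X) = ∈-++⁺ˡ (∈-map⁺ (inside ∷_) (∈-subsets X))
∈-subsets (outside ∷ X) = ∈-++⁺ʳ (map (inside ∷_) (subsets _)) (∈-map⁺ (outside ∷_) (∈-subsets X))

∃-minimiser : ∀ {n} {P : Subset n → Set} → (∀ X → Dec (P X)) → (f : Subset n → ℕ) → ∀ {X} → P X →
              ∃[ Z ] P Z × (∀ V → P V → f Z ≤ f V)
∃-minimiser {n} {P} P? f {X} PX = go (suc (f X)) X PX ≤-refl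
  where
  go : ∀ d Z → P Z → f Z < d → ∃[ Z ] P Z × (∀ V → P V → f Z ≤ f V)
  go (suc d) Z PZ (s≤s fZ≤d) with anySubset? (λ V → P? V ×-dec (f V <? f Z))
  ... | yes (V , PV , fV<fZ) = go d V PV (<-≤-trans fV<fZ fZ≤d)
  ... | no none = Z , PZ , λ V PV → ≮⇒≥ (λ fV<fZ → none (V , PV , fV<fZ))

-- The length bound makes the search finite; a duplicate-free list of subsets is never longer than
-- `subsets n`.
∃-bounded-list? : ∀ {n} (N : ℕ) {P : List (Subset n) → Set} → (∀ σ → Dec (P σ)) →
                  Dec (∃[ σ ] length σ ≤ N × P σ)
∃-bounded-list? zero P? = map′ (λ p → [] , z≤n , p) (λ { ([] , _ , p) → p }) (P? [])
∃-bounded-list? (suc N) P? with P? []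
... | yes p = yes ([] , z≤n , p)
... | no ¬p = map′ (λ { (X , σ , l , p) → X ∷ σ , s≤s l , p })
                   (λ { ([] , _ , p) → contradiction p ¬p ; (X ∷ σ , s≤s l , p) → X , σ , l , p })
                   (anySubset? (λ X → ∃-bounded-list? N (λ σ → P? (X ∷ σ))))

∁-involutive : ∀ {n} (X : Subset n) → ∁ (∁ X) ≡ X
∁-involutive X = ⊆-antisym (x∉∁p⇒x∈p ∘ x∈∁p⇒x∉p) (x∉p⇒x∈∁p ∘ x∈p⇒x∉∁p)

⊆∁-sym : ∀ {n} {X Y : Subset n} → X ⊆ ∁ Y → Y ⊆ ∁ X
⊆∁-sym X⊆∁Y y∈Y = x∉p⇒x∈∁p (λ y∈X → x∈∁p⇒x∉p (X⊆∁Y y∈X) y∈Y)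

∁⊆∁⇒⊇ : ∀ {n} {X Y : Subset n} → ∁ X ⊆ ∁ Y → Y ⊆ X
∁⊆∁⇒⊇ {X = X} {Y} sub = subst (Y ⊆_) (∁-involutive X) (⊆∁-sym sub)

_≟ˢ_ : ∀ {n} (X Y : Subset n) → Dec (X ≡ Y)
_≟ˢ_ = ≡-dec Boolₚ._≟_

⊆∧∣∣≥⇒≡ : ∀ {n} {X Y : Subset n} → X ⊆ Y → ∣ Y ∣ ≤ ∣ X ∣ → X ≡ Y
⊆∧∣∣≥⇒≡ {X = X} {Y} X⊆Y ∣Y∣≤∣X∣ = ⊆-antisym X⊆Y λ {x} x∈Y → x∈X x∈Y (x ∈ˢ? X)
  where
  x∈X : ∀ {x} → x ∈ˢ Y → Dec (x ∈ˢ X) → x ∈ˢ X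
  x∈X _ (yes x∈X) = x∈X
  x∈X x∈Y (no x∉X) = contradiction (p⊂q⇒∣p∣<∣q∣ (X⊆Y , _ , x∈Y , x∉X)) (≤⇒≯ ∣Y∣≤∣X∣)

Disj : ∀ {n} → Subset n → Subset n → Set
Disj X Y = X ⊆ ∁ Y

-- Connectivity and low-norm stars, free of subtraction.

module Duality {n : ℕ} (M : Matroid n) (k : ℕ) where
  open Matroid M
  open DecMembership (_≟ˢ_ {n}) using (_∈?_)

  R : ℕ
  R = rM M

  -- s X is λ(X) + r(M).
  s : Subset n → ℕ
  s X = r X + r (∁ X)

  Small : Subset n → Set
  Small X = s X < k + R

  Small? : ∀ X → Dec (Small X)
  Small? X = s X <? k + R

  co : List (Subset n) → ℕ
  co σ = sum (map (λ X → r (∁ X)) σ)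

  -- The norm of σ is less than k, with r(M) moved to the right so that no subtraction occurs.
  -- Disjointness is by position: ∅ may be repeated. Good [] says that r(M) < k.
  Good : List (Subset n) → Set
  Good σ = AllPairs Disj σ × co σ + R < k + length σ * R

  Good? : ∀ σ → Dec (Good σ)
  Good? σ = allPairs? (λ X Y → X ⊆? ∁ Y) σ ×-dec (co σ + R <? k + length σ * R)

  Good-↭ : ∀ {σ σ′} → σ ↭ σ′ → Good σ → Good σ′
  Good-↭ {σ} {σ′} p (disj , lt) =
      SetoidPerm.AllPairs-resp-↭ (setoid (Subset n)) {R = Disj} ⊆∁-sym (resp₂ Disj) (↭⇒↭ₛ p) disj
    , subst (λ m → co σ′ + R < k + m * R) (↭-length p)
        (subst (λ c → c + R < k + length σ * R) (sum-↭ (map⁺ _ p)) lt)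

  s-∁ : ∀ X → s (∁ X) ≡ s X
  s-∁ X = trans (cong (λ Y → r (∁ X) + r Y) (∁-involutive X)) (+-comm (r (∁ X)) (r X))

  -- Add submodularity of `r` for `X`, `Y` to that for their complements, using De Morgan.
  s-submod : ∀ X Y → s (X ∩ Y) + s (X ∪ Y) ≤ s X + s Y
  s-submod X Y = begin
    (r (X ∩ Y) + r (∁ (X ∩ Y))) + (r (X ∪ Y) + r (∁ (X ∪ Y)))
      ≤⟨ +-mono-≤ (+-monoʳ-≤ (r (X ∩ Y)) (r-mono ∁∩⊆)) (+-monoʳ-≤ (r (X ∪ Y)) (r-mono ∁∪⊆)) ⟩
    (r (X ∩ Y) + r (∁ X ∪ ∁ Y)) + (r (X ∪ Y) + r (∁ X ∩ ∁ Y))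
      ≡⟨ arrange (r (X ∩ Y)) (r (∁ X ∪ ∁ Y)) (r (X ∪ Y)) (r (∁ X ∩ ∁ Y)) ⟩
    (r (X ∪ Y) + r (X ∩ Y)) + (r (∁ X ∪ ∁ Y) + r (∁ X ∩ ∁ Y))
      ≤⟨ +-mono-≤ (r-submod X Y) (r-submod (∁ X) (∁ Y)) ⟩
    (r X + r Y) + (r (∁ X) + r (∁ Y))
      ≡⟨ arrange′ (r X) (r Y) (r (∁ X)) (r (∁ Y)) ⟩
    s X + s Y ∎
    where
    open ≤-Reasoning
    arrange : ∀ a b c d → (a + b) + (c + d) ≡ (c + a) + (b + d)
    arrange = solve-∀
    arrange′ : ∀ a b c d → (a + b) + (c + d) ≡ (a + c) + (b + d)
    arrange′ = solve-∀
    ∁∩⊆ : ∁ (X ∩ Y) ⊆ ∁ X ∪ ∁ Y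
    ∁∩⊆ {x} h with x ∈ˢ? X
    ... | yes x∈X = x∈p∪q⁺ (inj₂ (x∉p⇒x∈∁p (λ x∈Y → x∈∁p⇒x∉p h (x∈p∩q⁺ (x∈X , x∈Y)))))
    ... | no x∉X = x∈p∪q⁺ (inj₁ (x∉p⇒x∈∁p x∉X))
    ∁∪⊆ : ∁ (X ∪ Y) ⊆ ∁ X ∩ ∁ Y
    ∁∪⊆ h = x∈p∩q⁺ ( x∉p⇒x∈∁p (λ x∈X → x∈∁p⇒x∉p h (x∈p∪q⁺ (inj₁ x∈X)))
                   , x∉p⇒x∈∁p (λ x∈Y → x∈∁p⇒x∉p h (x∈p∪q⁺ (inj₂ x∈Y))) )

  -- The complement of the union of the list.
  rest : List (Subset n) → Subset n
  rest [] = full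
  rest (X ∷ Xs) = ∁ X ∩ rest Xs

  ⊆rest : ∀ {A Xs} → All (Disj A) Xs → A ⊆ rest Xs
  ⊆rest [] = ⊆⊤
  ⊆rest (d ∷ ds) x∈A = x∈p∩q⁺ (d x∈A , ⊆rest ds x∈A)

  -- Uncrosses one member `X` at a time, by submodularity for `∁ X` and `D = rest Xs ∩ ∁ Y`. As `X`
  -- is disjoint from the later members, its part outside `Y` lies in `D`, so `∁ (X ∩ Y) ⊆ ∁ X ∪ D`.
  co-∩ : ∀ {Xs} Y → AllPairs Disj Xs → co (map (_∩ Y) Xs) + r (rest Xs ∩ ∁ Y) ≤ co Xs + r (∁ Y)
  co-∩ Y [] = r-mono (p∩q⊆q full (∁ Y))
  co-∩ {X ∷ Xs} Y (disj ∷ disjs) = begin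
    r (∁ (X ∩ Y)) + co XsY + r ((∁ X ∩ rest Xs) ∩ ∁ Y)
      ≤⟨ +-mono-≤ (+-monoˡ-≤ (co XsY) (r-mono ∁∩⊆)) (r-mono ∩⊆) ⟩
    r (∁ X ∪ D) + co XsY + r (∁ X ∩ D)
      ≡⟨ arrange (r (∁ X ∪ D)) (co XsY) (r (∁ X ∩ D)) ⟩
    (r (∁ X ∪ D) + r (∁ X ∩ D)) + co XsY
      ≤⟨ +-monoˡ-≤ (co XsY) (r-submod (∁ X) D) ⟩
    r (∁ X) + r D + co XsY
      ≡⟨ arrange′ (r (∁ X)) (r D) (co XsY) ⟩
    r (∁ X) + (co XsY + r D)
      ≤⟨ +-monoʳ-≤ (r (∁ X)) (co-∩ Y disjs) ⟩
    r (∁ X) + (co Xs + r (∁ Y))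
      ≡⟨ sym (+-assoc (r (∁ X)) (co Xs) (r (∁ Y))) ⟩
    r (∁ X) + co Xs + r (∁ Y) ∎
    where
    open ≤-Reasoning
    D : Subset n
    D = rest Xs ∩ ∁ Y
    XsY : List (Subset n)
    XsY = map (_∩ Y) Xs
    arrange : ∀ a b c → a + b + c ≡ (a + c) + b
    arrange = solve-∀
    arrange′ : ∀ a b c → a + b + c ≡ a + (c + b)
    arrange′ = solve-∀
    ∁∩⊆ : ∁ (X ∩ Y) ⊆ ∁ X ∪ D
    ∁∩⊆ {x} h with x ∈ˢ? X
    ... | yes x∈X = x∈p∪q⁺ (inj₂ (x∈p∩q⁺ ( ⊆rest disj x∈X
                                         , x∉p⇒x∈∁p (λ x∈Y → x∈∁p⇒x∉p h (x∈p∩q⁺ (x∈X , x∈Y))))))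
    ... | no x∉X = x∈p∪q⁺ (inj₁ (x∉p⇒x∈∁p x∉X))
    ∩⊆ : (∁ X ∩ rest Xs) ∩ ∁ Y ⊆ ∁ X ∩ D
    ∩⊆ h with x∈p∩q⁻ (∁ X ∩ rest Xs) (∁ Y) h
    ... | h′ , x∈∁Y with x∈p∩q⁻ (∁ X) (rest Xs) h′
    ... | x∈∁X , x∈rest = x∈p∩q⁺ (x∈∁X , x∈p∩q⁺ (x∈rest , x∈∁Y))

  co-∅ : ∀ Xs → length Xs * R ≤ co (map (_∩ ∅) Xs)
  co-∅ [] = z≤n
  co-∅ (X ∷ Xs) = +-mono-≤ (r-mono λ _ → x∉p⇒x∈∁p (∉⊥ ∘ p∩q⊆q X ∅)) (co-∅ Xs)

  -- Apply `co-∩` with `Y = ∅`: every other member shrinks to `∅` and contributes r(M), while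
  -- `A ⊆ rest Xs`. Members of low-norm stars thus lie in S_k automatically.
  Good⇒Small : ∀ {A Xs} → Good (A ∷ Xs) → Small A
  Good⇒Small {A} {Xs} (disj ∷ disjs , lt) = +-cancelʳ-< (length Xs * R) (s A) (k + R) (begin-strict
    s A + length Xs * R
      ≤⟨ +-mono-≤ (+-monoˡ-≤ (r (∁ A)) (r-mono A⊆)) (co-∅ Xs) ⟩
    r (rest Xs ∩ ∁ ∅) + r (∁ A) + co (map (_∩ ∅) Xs)
      ≡⟨ arrange (r (rest Xs ∩ ∁ ∅)) (r (∁ A)) (co (map (_∩ ∅) Xs)) ⟩
    r (∁ A) + (co (map (_∩ ∅) Xs) + r (rest Xs ∩ ∁ ∅))
      ≤⟨ +-monoʳ-≤ (r (∁ A)) (co-∩ ∅ disjs) ⟩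
    r (∁ A) + (co Xs + r (∁ ∅))
      ≤⟨ +-monoʳ-≤ (r (∁ A)) (+-monoʳ-≤ (co Xs) (r-mono ⊆⊤)) ⟩
    r (∁ A) + (co Xs + R)
      ≡⟨ sym (+-assoc (r (∁ A)) (co Xs) R) ⟩
    co (A ∷ Xs) + R
      <⟨ lt ⟩
    k + (R + length Xs * R)
      ≡⟨ sym (+-assoc k R (length Xs * R)) ⟩
    k + R + length Xs * R ∎)
    where
    open ≤-Reasoning
    arrange : ∀ a b c → a + b + c ≡ b + (c + a)
    arrange = solve-∀
    A⊆ : A ⊆ rest Xs ∩ ∁ ∅
    A⊆ x∈A = x∈p∩q⁺ (⊆rest disj x∈A , x∉p⇒x∈∁p ∉⊥)

  -- Branches, conflicts and shifting.

  -- X ∈ Br Q: the part X of the ground set is carried by a rooted tree of low-norm stars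
  -- whose root star contains ∁ X, pointing to the outside of the tree.
  data Br (Q : List (Subset n)) : Subset n → Set where
    leaf : ∀ {X} → X ∈ Q → Br Q X
    node : ∀ {X} Xs → All (Br Q) Xs → Good (∁ X ∷ Xs) → Br Q X

  Conflict : List (Subset n) → Set
  Conflict Q = ∃[ X ] Br Q X × Br Q (∁ X)

  -- Closure under smaller separations keeps restricted leaves in `Q` when a tree is shifted, and
  -- makes a complete `Q` consistent.
  Valid : List (Subset n) → Set
  Valid Q = (∀ {X} → X ∈ Q → Small X) × (∀ {X Y} → X ∈ Q → Y ⊆ X → Small Y → Y ∈ Q)

  -- Restricting every separation below X to Y does not raise the norm of a star,
  -- because Y has the least connectivity among the sets between Y and X.
  module _ {Q : List (Subset n)} (valid : Valid Q) {X Y : Subset n} (Y⊆X : Y ⊆ X)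
           (least : ∀ {Z} → Y ⊆ Z → Z ⊆ X → s Y ≤ s Z) where

    Good-∩ : ∀ {W Ws} → W ⊆ X → Good (∁ W ∷ Ws) → Good (∁ (W ∩ Y) ∷ map (_∩ Y) Ws)
    Good-∩ {W} {Ws} W⊆X (disj ∷ disjs , lt) = (head-disj disj ∷ tail-disj disjs) , num
      where
      head-disj : ∀ {Vs} → All (Disj (∁ W)) Vs → All (Disj (∁ (W ∩ Y))) (map (_∩ Y) Vs)
      head-disj [] = []
      head-disj {V ∷ _} (d ∷ ds) = p⊆q⇒∁p⊇∁q (λ h → let (x∈V , x∈Y) = x∈p∩q⁻ V Y h in
                                     x∈p∩q⁺ (∁⊆∁⇒⊇ d x∈V , x∈Y)) ∷ head-disj ds
      ∩-disj : ∀ {V Vs} → All (Disj V) Vs → All (Disj (V ∩ Y)) (map (_∩ Y) Vs)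
      ∩-disj [] = []
      ∩-disj {V} {V′ ∷ _} (d ∷ ds) =
        (λ h → x∉p⇒x∈∁p (λ h′ → x∈∁p⇒x∉p (d (p∩q⊆p V Y h)) (p∩q⊆p V′ Y h′))) ∷ ∩-disj ds
      tail-disj : ∀ {Vs} → AllPairs Disj Vs → AllPairs Disj (map (_∩ Y) Vs)
      tail-disj [] = []
      tail-disj (d ∷ ds) = ∩-disj d ∷ tail-disj ds

      -- `Z` is the union of `Y` and all of `Ws`. It lies between `Y` and `X`, so `least` applies to
      -- it.
      D Z : Subset n
      D = rest Ws ∩ ∁ Y
      Z = ∁ D
      Z⊆W∪Y : Z ⊆ W ∪ Y
      Z⊆W∪Y {x} x∈Z with x ∈ˢ? Y | x ∈ˢ? W
      ... | yes x∈Y | _ = x∈p∪q⁺ (inj₂ x∈Y)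
      ... | no _ | yes x∈W = x∈p∪q⁺ (inj₁ x∈W)
      ... | no x∉Y | no x∉W =
        contradiction (x∈p∩q⁺ (⊆rest disj (x∉p⇒x∈∁p x∉W) , x∉p⇒x∈∁p x∉Y)) (x∈∁p⇒x∉p x∈Z)
      Z⊆X : Z ⊆ X
      Z⊆X = [ W⊆X , Y⊆X ]′ ∘ x∈p∪q⁻ W Y ∘ Z⊆W∪Y
      Y⊆Z : Y ⊆ Z
      Y⊆Z x∈Y = x∉p⇒x∈∁p (λ h → x∈∁p⇒x∉p (p∩q⊆q (rest Ws) (∁ Y) h) x∈Y)

      open ≤-Reasoning
      arrange₁ : ∀ a b c d → a + b + (c + d) ≡ c + a + (b + d)
      arrange₁ = solve-∀
      arrange₂ : ∀ a b c d → a + b + (c + d) ≡ a + c + (b + d)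
      arrange₂ = solve-∀
      -- Submodularity for `W`, `Y` is added to `co-∩` for `Ws`; the surplus `s Y` is at most `s Z`,
      -- which is at most the terms `r (W ∪ Y) + r D` to be cancelled.
      key : r (W ∩ Y) + co (map (_∩ Y) Ws) ≤ r W + co Ws
      key = +-cancelʳ-≤ (r (W ∪ Y) + r D) _ _ (begin
        r (W ∩ Y) + co (map (_∩ Y) Ws) + (r (W ∪ Y) + r D)
          ≡⟨ arrange₁ (r (W ∩ Y)) (co (map (_∩ Y) Ws)) (r (W ∪ Y)) (r D) ⟩
        r (W ∪ Y) + r (W ∩ Y) + (co (map (_∩ Y) Ws) + r D)
          ≤⟨ +-mono-≤ (r-submod W Y) (co-∩ Y disjs) ⟩
        r W + r Y + (co Ws + r (∁ Y))
          ≡⟨ arrange₂ (r W) (r Y) (co Ws) (r (∁ Y)) ⟩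
        r W + co Ws + s Y
          ≤⟨ +-monoʳ-≤ (r W + co Ws) (least Y⊆Z Z⊆X) ⟩
        r W + co Ws + (r Z + r (∁ Z))
          ≤⟨ +-monoʳ-≤ (r W + co Ws) (+-mono-≤ (r-mono Z⊆W∪Y) (≤-reflexive (cong r (∁-involutive D)))) ⟩
        r W + co Ws + (r (W ∪ Y) + r D) ∎)
      num : co (∁ (W ∩ Y) ∷ map (_∩ Y) Ws) + R < k + (R + length (map (_∩ Y) Ws) * R)
      num = begin-strict
        r (∁ (∁ (W ∩ Y))) + co (map (_∩ Y) Ws) + R
          ≡⟨ cong (λ V → r V + co (map (_∩ Y) Ws) + R) (∁-involutive (W ∩ Y)) ⟩
        r (W ∩ Y) + co (map (_∩ Y) Ws) + R
          ≤⟨ +-monoˡ-≤ R key ⟩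
        r W + co Ws + R
          ≡⟨ cong (λ V → r V + co Ws + R) (sym (∁-involutive W)) ⟩
        r (∁ (∁ W)) + co Ws + R
          <⟨ lt ⟩
        k + (R + length Ws * R)
          ≡⟨ cong (λ m → k + (R + m * R)) (sym (length-map (_∩ Y) Ws)) ⟩
        k + (R + length (map (_∩ Y) Ws) * R) ∎

    -- The whole tree is intersected with `Y`; disjointness from `∁ W` keeps the children inside
    -- `W`, hence inside `X`. A leaf `W` stays small: `s Y ≤ s (W ∪ Y)` by `least`, so submodularity
    -- gives `s (W ∩ Y) ≤ s W`.
    Br-∩ : ∀ {W} → W ⊆ X → Br Q W → Br Q (W ∩ Y)
    Brs-∩ : ∀ {W Ws} → W ⊆ X → All (Disj (∁ W)) Ws → All (Br Q) Ws → All (Br Q) (map (_∩ Y) Ws)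
    Br-∩ {W} W⊆X (leaf W∈Q) = leaf (proj₂ valid W∈Q (p∩q⊆p W Y) small)
      where
      open ≤-Reasoning
      small : Small (W ∩ Y)
      small = ≤-<-trans (+-cancelʳ-≤ (s Y) _ _ (begin
        s (W ∩ Y) + s Y        ≤⟨ +-monoʳ-≤ (s (W ∩ Y)) (least (q⊆p∪q W Y) ([ W⊆X , Y⊆X ]′ ∘ x∈p∪q⁻ W Y)) ⟩
        s (W ∩ Y) + s (W ∪ Y)  ≤⟨ s-submod W Y ⟩
        s W + s Y              ∎)) (proj₁ valid W∈Q)
    Br-∩ W⊆X (node Ws brs good@(disj ∷ _ , _)) =
      node (map (_∩ Y) Ws) (Brs-∩ W⊆X disj brs) (Good-∩ W⊆X good)
    Brs-∩ W⊆X [] [] = []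
    Brs-∩ W⊆X (d ∷ ds) (br ∷ brs) = Br-∩ (W⊆X ∘ ∁⊆∁⇒⊇ d) br ∷ Brs-∩ W⊆X ds brs

    Br-shift : Br Q X → Br Q Y
    Br-shift br = subst (Br Q) (⊆-antisym (p∩q⊆q X Y) (λ y → x∈p∩q⁺ (Y⊆X y , y))) (Br-∩ ⊆-refl br)

  -- One `Z` of least connectivity between `Y` and `X` serves both shifts: `s` is invariant under
  -- complement, so `∁ Z` is least among the sets between `∁ Z` and `∁ Y`.
  Br-crossing : ∀ {Q} → Valid Q → ∀ {X Y} → Y ⊆ X → Br Q X → Br Q (∁ Y) → Conflict Q
  Br-crossing {Q} valid {X} {Y} Y⊆X brX brY
    with ∃-minimiser (λ Z → (Y ⊆? Z) ×-dec (Z ⊆? X)) s {Y} (⊆-refl , Y⊆X)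
  ... | Z , (Y⊆Z , Z⊆X) , least =
      Z , Br-shift valid Z⊆X (λ Z⊆V V⊆X → least _ (⊆-trans Y⊆Z Z⊆V , V⊆X)) brX
        , Br-shift valid (p⊆q⇒∁p⊇∁q Y⊆Z) least′ brY
    where
    least′ : ∀ {V} → ∁ Z ⊆ V → V ⊆ ∁ Y → s (∁ Z) ≤ s V
    least′ {V} ∁Z⊆V V⊆∁Y =
      subst (_≤ s V) (sym (s-∁ Z)) (subst (s Z ≤_) (s-∁ V) (least (∁ V) (⊆∁-sym V⊆∁Y , ∁V⊆X)))
      where
      ∁V⊆X : ∁ V ⊆ X
      ∁V⊆X = Z⊆X ∘ ∁⊆∁⇒⊇ (subst (∁ Z ⊆_) (sym (∁-involutive V)) ∁Z⊆V)

  -- Rerooting trees and removing a leaf.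

  module _ (0<k : 0 < k) where

    -- The one-element star at the ground set has norm r(∅) = 0, which is below `k`.
    Br-∅ : ∀ {Q} → Br Q ∅
    Br-∅ = node [] [] ([] ∷ [] , lt)
      where
      open ≤-Reasoning
      r∅ : r (∁ (∁ ∅)) ≤ 0
      r∅ = begin
        r (∁ (∁ ∅))  ≡⟨ cong r (∁-involutive ∅) ⟩
        r ∅          ≤⟨ r-bounded ∅ ⟩
        ∣ ∅ {n} ∣    ≡⟨ ∣⊥∣≡0 n ⟩
        0            ∎
      lt : r (∁ (∁ ∅)) + 0 + R < k + (R + 0)
      lt = begin-strict
        r (∁ (∁ ∅)) + 0 + R ≤⟨ +-monoˡ-≤ R (+-monoˡ-≤ 0 r∅) ⟩
        R                   <⟨ m<n+m R 0<k ⟩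
        k + R               ≡⟨ cong (λ j → k + j) (sym (+-identityʳ R)) ⟩
        k + (R + 0)         ∎

    -- A leaf Y inside ∁ Y is empty.
    Br-drop : ∀ {Q Y V} → V ⊆ ∁ Y → Br (Y ∷ Q) V → Br Q V
    Brs-drop : ∀ {Q Y V Vs} → V ⊆ ∁ Y → All (Disj (∁ V)) Vs → All (Br (Y ∷ Q)) Vs → All (Br Q) Vs
    Br-drop {Q} Y⊆∁Y (leaf (here refl)) =
      subst (Br Q) (⊆-antisym (⊥-elim ∘ ∉⊥) (λ y → contradiction y (x∈∁p⇒x∉p (Y⊆∁Y y)))) Br-∅
    Br-drop _ (leaf (there V∈Q)) = leaf V∈Q
    Br-drop V⊆∁Y (node Vs brs good@(disj ∷ _ , _)) = node Vs (Brs-drop V⊆∁Y disj brs) good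
    Brs-drop V⊆∁Y [] [] = []
    Brs-drop V⊆∁Y (d ∷ ds) (br ∷ brs) = Br-drop (V⊆∁Y ∘ ∁⊆∁⇒⊇ d) br ∷ Brs-drop V⊆∁Y ds brs

    -- Either the leaf Y does not occur, or the tree can be rerooted at an occurrence of it.
    reroot : ∀ {Q Y W} → Br (Y ∷ Q) W → Br Q W ⊎ (Br (Y ∷ Q) (∁ W) → Br (Y ∷ Q) (∁ Y))
    -- `ps` collects the children already found free of `Y`. When `Y` occurs below a child `X`, the
    -- remaining children together with `∁ W` form a node displaying `∁ X`, from which rerooting
    -- continues.
    reroots : ∀ {Q Y W} ps {Ws σ} → All (Br (Y ∷ Q)) ps → All (Br (Y ∷ Q)) Ws →
              σ ↭ ps ++ Ws → Good (∁ W ∷ σ) →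
              All (Br Q) Ws ⊎ (Br (Y ∷ Q) (∁ W) → Br (Y ∷ Q) (∁ Y))
    reroot (leaf (here refl)) = inj₂ id
    reroot (leaf (there W∈Q)) = inj₁ (leaf W∈Q)
    reroot (node Ws brs good) with reroots [] [] brs ↭-refl good
    ... | inj₁ brs′ = inj₁ (node Ws brs′ good)
    ... | inj₂ f = inj₂ f
    reroots ps _ [] _ _ = inj₁ []
    reroots {Q} {Y} {W} ps {X ∷ Ws} {σ} brps (br ∷ brs) perm good with reroot br
    ... | inj₂ f = inj₂ (λ br∁W → f (node (∁ W ∷ ps ++ Ws) (br∁W ∷ ++⁺ brps brs) good′))
      where
      good′ : Good (∁ (∁ X) ∷ ∁ W ∷ ps ++ Ws)
      good′ = subst (λ V → Good (V ∷ ∁ W ∷ ps ++ Ws)) (sym (∁-involutive X))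
                (Good-↭ (↭-trans (prep (∁ W) (↭-trans perm (shift X ps Ws))) (swap (∁ W) X ↭-refl)) good)
    ... | inj₁ br′ with reroots (X ∷ ps) (br ∷ brps) brs (↭-trans perm (shift X ps Ws)) good
    ...   | inj₁ brs′ = inj₁ (br′ ∷ brs′)
    ...   | inj₂ f = inj₂ f

    -- If `Y` occurs as a leaf on either side, rerooting there displays `∁ Y`, and the remaining
    -- leaves `Y` can then be dropped.
    Conflict-∷⁻ : ∀ {Q Y} → Conflict (Y ∷ Q) → Conflict Q ⊎ Br Q (∁ Y)
    Conflict-∷⁻ {Q} {Y} (X , br , br∁) with reroot br
    ... | inj₂ f = inj₂ (Br-drop ⊆-refl (f br∁))
    ... | inj₁ brQ with reroot br∁
    ...   | inj₂ f = inj₂ (Br-drop ⊆-refl (f (subst (Br (Y ∷ Q)) (sym (∁-involutive X)) br)))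
    ...   | inj₁ br∁Q = inj₁ (X , brQ , br∁Q)

    -- Extending `Q` to a tangle.

    Undecided : List (Subset n) → Subset n → Set
    Undecided Q X = Small X × X ∉ Q × ∁ X ∉ Q

    Undecided? : ∀ Q X → Dec (Undecided Q X)
    Undecided? Q X = Small? X ×-dec ¬? (X ∈? Q) ×-dec ¬? (∁ X ∈? Q)

    Minimal-undecided : List (Subset n) → Subset n → Set
    Minimal-undecided Q Y = Undecided Q Y × (∀ {Z} → Undecided Q Z → Z ⊆ Y → Z ≡ Y)

    minimal-undecided : ∀ {Q X} → Undecided Q X → ∃[ Y ] Y ⊆ X × Minimal-undecided Q Y
    minimal-undecided {Q} {X} und
      with ∃-minimiser (λ Y → Undecided? Q Y ×-dec (Y ⊆? X)) ∣_∣ (und , ⊆-refl)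
    ... | Y , (undY , Y⊆X) , least =
        Y , Y⊆X , undY , λ undZ Z⊆Y → ⊆∧∣∣≥⇒≡ Z⊆Y (least _ (undZ , ⊆-trans Z⊆Y Y⊆X))

    -- A small `Z ⊆ Y` outside `Q` is undecided, since `∁ Z ∈ Q` would put the smaller `∁ Y` in `Q`;
    -- minimality then gives `Z ≡ Y`.
    Valid-∷ : ∀ {Q Y} → Valid Q → Minimal-undecided Q Y → Valid (Y ∷ Q)
    Valid-∷ {Q} {Y} (small , down) ((smallY , _ , ∁Y∉Q) , minimal) = small′ , down′
      where
      small′ : ∀ {X} → X ∈ Y ∷ Q → Small X
      small′ (here refl) = smallY
      small′ (there X∈Q) = small X∈Q
      down′ : ∀ {X Z} → X ∈ Y ∷ Q → Z ⊆ X → Small Z → Z ∈ Y ∷ Q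
      down′ (there X∈Q) Z⊆X smallZ = there (down X∈Q Z⊆X smallZ)
      down′ {Z = Z} (here refl) Z⊆Y smallZ with Z ∈? Q
      ... | yes Z∈Q = there Z∈Q
      ... | no Z∉Q = here (minimal (smallZ , Z∉Q , λ ∁Z∈Q → ∁Y∉Q
                       (down ∁Z∈Q (p⊆q⇒∁p⊇∁q Z⊆Y) (subst (_< k + R) (sym (s-∁ Y)) smallY))) Z⊆Y)

    -- A tangle whose set of members is the list Q.
    record Tangle (Q : List (Subset n)) : Set where
      field
        valid    : Valid Q
        total    : ∀ {X} → Small X → X ∈ Q ⊎ ∁ X ∈ Q
        antisym  : ∀ {X} → X ∈ Q → ∁ X ∉ Q
        no-star  : ∀ {X σ} → Unique (X ∷ σ) → All (_∈ Q) (X ∷ σ) → ¬ Good (X ∷ σ)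

    Star-in : List (Subset n) → List (Subset n) → Set
    Star-in Q σ = σ ≢ [] × All (_∈ Q) σ × Good σ

    Star-in? : ∀ Q σ → Dec (Star-in Q σ)
    Star-in? Q [] = no (λ h → proj₁ h refl)
    Star-in? Q (X ∷ σ) = yes (λ ()) ×-dec All.all? (_∈? Q) (X ∷ σ) ×-dec Good? (X ∷ σ)

    -- Whatever keeps `Q` from being a tangle is a conflict: two opposite leaves, or a low-norm star
    -- in `Q`, which displays `∁ X` for its first member `X`.
    finish : ∀ {Q} → Valid Q → (∀ X → ¬ Undecided Q X) → ∃ Tangle ⊎ Conflict Q
    finish {Q} valid none with anySubset? (λ X → (X ∈? Q) ×-dec (∁ X ∈? Q))
    ... | yes (X , X∈Q , ∁X∈Q) = inj₂ (X , leaf X∈Q , leaf ∁X∈Q)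
    ... | no antisym with ∃-bounded-list? (length (subsets n)) (Star-in? Q)
    ...   | yes ([] , _ , []≢[] , _) = contradiction refl []≢[]
    ...   | yes (X ∷ σ , _ , _ , X∈Q ∷ σ⊆Q , good) =
            inj₂ (X , leaf X∈Q , node σ (All.map leaf σ⊆Q)
                                   (subst (λ V → Good (V ∷ σ)) (sym (∁-involutive X)) good))
    ...   | no ¬star = inj₁ (Q , record
            { valid = valid
            ; total = total
            ; antisym = λ X∈Q ∁X∈Q → antisym (_ , X∈Q , ∁X∈Q)
            ; no-star = λ {X} {σ} uniq σ⊆Q good →
                ¬star (X ∷ σ , Unique-length uniq (λ _ → ∈-subsets _) , (λ ()) , σ⊆Q , good)
            })
      where
      total : ∀ {X} → Small X → X ∈ Q ⊎ ∁ X ∈ Q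
      total {X} small with X ∈? Q | ∁ X ∈? Q
      ... | yes X∈Q | _ = inj₁ X∈Q
      ... | no _ | yes ∁X∈Q = inj₂ ∁X∈Q
      ... | no X∉Q | no ∁X∉Q = contradiction (small , X∉Q , ∁X∉Q) (none X)

    -- If Q extends neither by a minimal undecided Y nor by a minimal undecided Y′ ⊆ ∁ Y,
    -- then ∁ Y and ∁ Y′ are branches covering the ground set, and they shift to a conflict.
    tangle-or-conflict : ∀ d {Q} → length (subsets n) < length Q + d → Unique Q → Valid Q →
                         ∃ Tangle ⊎ Conflict Q
    -- The fuel can run out only for a duplicate-free `Q` longer than the list of all subsets.
    tangle-or-conflict zero {Q} bound uniq _ =
      contradiction (Unique-length uniq (λ _ → ∈-subsets _))
                    (<⇒≱ (subst (length (subsets n) <_) (+-identityʳ (length Q)) bound))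
    tangle-or-conflict (suc d) {Q} bound uniq valid with anySubset? (Undecided? Q)
    ... | no none = finish valid (λ X und → none (X , und))
    ... | yes (X , undX) = try-both (minimal-undecided undX)
      where
      try : ∀ {Y} → Minimal-undecided Q Y → ∃ Tangle ⊎ (Conflict Q ⊎ Br Q (∁ Y))
      try {Y} minY@((_ , Y∉Q , _) , _)
        with tangle-or-conflict d {Y ∷ Q} (subst (length (subsets n) <_) (+-suc (length Q) d) bound)
               (¬Any⇒All¬ Q Y∉Q ∷ uniq) (Valid-∷ valid minY)
      ... | inj₁ tangle = inj₁ tangle
      ... | inj₂ conflict = inj₂ (Conflict-∷⁻ conflict)
      try-both : ∃[ Y ] Y ⊆ X × Minimal-undecided Q Y → ∃ Tangle ⊎ Conflict Q
      try-both (Y , _ , minY@((smallY , Y∉Q , ∁Y∉Q) , _)) with try minY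
      ... | inj₁ tangle = inj₁ tangle
      ... | inj₂ (inj₁ conflict) = inj₂ conflict
      ... | inj₂ (inj₂ br∁Y)
        with minimal-undecided {Q} {∁ Y} ( subst (_< k + R) (sym (s-∁ Y)) smallY , ∁Y∉Q
                                         , subst (_∉ Q) (sym (∁-involutive Y)) Y∉Q )
      ...   | Y′ , Y′⊆∁Y , minY′ with try minY′
      ...     | inj₁ tangle = inj₁ tangle
      ...     | inj₂ (inj₁ conflict) = inj₂ conflict
      ...     | inj₂ (inj₂ br∁Y′) = inj₂ (Br-crossing valid Y′⊆∁Y br∁Y br∁Y′)

    duality : ∃ Tangle ⊎ Conflict []
    duality = tangle-or-conflict (suc (length (subsets n))) ≤-refl [] ((λ ()) , λ ())

-- Paths and simple paths.

data Path {A : Set} (R : A → A → Set) : A → List A → A → Set where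
  []  : ∀ {x} → Path R x [] x
  _∷_ : ∀ {x y ps z} → R x y → Path R y ps z → Path R x (y ∷ ps) z

Path-map : ∀ {A : Set} {R S : A → A → Set} → (∀ {x y} → R x y → S x y) →
           ∀ {x ps z} → Path R x ps z → Path S x ps z
Path-map f [] = []
Path-map f (e ∷ p) = f e ∷ Path-map f p

Path-suffix : ∀ {A : Set} {R : A → A → Set} {x y ps z} → x ∈ y ∷ ps → Path R y ps z → Unique (y ∷ ps) →
              ∃[ qs ] Path R x qs z × Unique (x ∷ qs)
Path-suffix (here refl) p u = _ , p , u
Path-suffix (there x∈ps) (_ ∷ p) (_ ∷ u) = Path-suffix x∈ps p u

Path-prefix : ∀ {A : Set} {R : A → A → Set} {x v us z} → Path R v us z → x ∈ us →
              ∃[ ps ] ∃[ qs ] us ≡ ps ++ qs × Path R v ps x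
Path-prefix {us = u ∷ us} (e ∷ p) (here refl) = [ u ] , us , refl , e ∷ []
Path-prefix (e ∷ p) (there x∈us) with Path-prefix p x∈us
... | ps , qs , refl , q = _ ∷ ps , qs , refl , e ∷ q

Unique-++⁻ˡ : ∀ {A : Set} (xs : List A) {ys} → Unique (xs ++ ys) → Unique xs
Unique-++⁻ˡ [] _ = []
Unique-++⁻ˡ (x ∷ xs) (d ∷ u) = ++⁻ˡ xs d ∷ Unique-++⁻ˡ xs u

Path-linked : ∀ {A : Set} {R : A → A → Set} {v ps z w} → Path R v ps z → R z w → Linked R (v ∷ ps ++ w ∷ [])
Path-linked [] e = e ∷ [-]
Path-linked (d ∷ p) e = d ∷ Path-linked p e

-- If prepending `x` closes a loop, the path is restarted at the later occurrence of `x`.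
simple-path : ∀ {m} {R : Fin m → Fin m → Set} {x z} → Star R x z → ∃[ ps ] Path R x ps z × Unique (x ∷ ps)
simple-path ε = [] , [] , [] ∷ []
simple-path {x = x} (_◅_ {j = y} e w) with simple-path w
... | ps , p , u with DecMembership._∈?_ _≟_ x (y ∷ ps)
...   | yes x∈ = Path-suffix x∈ p u
...   | no x∉ = y ∷ ps , e ∷ p , ¬Any⇒All¬ (y ∷ ps) x∉ ∷ u

∈-tabulate : ∀ {n} (f : Fin n → Bool) {e} → e ∈ˢ tabulate f ⇔ T (f e)
∈-tabulate f {e} = mk⇔
  (λ h → Equivalence.from Boolₚ.T-≡ (trans (sym (lookup∘tabulate f e)) ([]=⇒lookup h)))
  (λ h → lookup⇒[]= e (tabulate f) (trans (lookup∘tabulate f e) (Equivalence.to Boolₚ.T-≡ h)))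

-- Walks, edges and components in a tree.

module TreeTheory (Tr : Tree) where
  open Tree Tr

  Node : Set
  Node = Fin nodes

  Adj : Node → Node → Set
  Adj x y = T (adj x y)

  Adj-sym : ∀ {x y} → Adj x y → Adj y x
  Adj-sym {x} {y} = subst T (adj-sym x y)

  Adj-irr : ∀ {x y} → Adj x y → x ≢ y
  Adj-irr {x} e refl = subst T (adj-irr x) e

  no-cycle : ∀ {v ps z} → Path Adj v ps z → Unique (v ∷ ps) → 2 ≤ length ps → ¬ Adj z v
  no-cycle {v} {ps} p u l e = acyclic (v , ps , l , u , Path-linked p e)

  -- Following D from node to node never turns back, so in a tree it must stop.
  sink : (Q : Node → Set) (D : Node → Node → Set) → (∀ t → Q t ⊎ ∃[ x ] Adj t x × D t x) →
         (∀ {t x} → D t x → ¬ D x t) → Node → ∃ Q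
  sink Q D next no-return start = go (suc nodes) {start} [] ([] ∷ []) (λ ()) (s≤s (n≤1+n nodes))
    where
    -- The trail is stored with its newest node `v` first, and `from` says that the latest step
    -- followed `D`. A repeated node is `v` itself, the previous node, or closes a cycle.
    go : ∀ d {v us z} → Path Adj v us z → Unique (v ∷ us) → (∀ {u us′} → us ≡ u ∷ us′ → D u v) →
         nodes < length (v ∷ us) + d → ∃ Q
    go zero {v} {us} p u from bound =
      contradiction (subst (length (v ∷ us) ≤_) (length-tabulate id)
                       (Unique-length u (λ _ → ∈-allFin _)))
                    (<⇒≱ (subst (nodes <_) (+-identityʳ _) bound))
    go (suc d) {v} {us} p u from bound with next v
    ... | inj₁ q = v , q
    ... | inj₂ (x , e , dx) with DecMembership._∈?_ _≟_ x (v ∷ us)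
    ...   | no x∉ = go d (Adj-sym e ∷ p) (¬Any⇒All¬ (v ∷ us) x∉ ∷ u) (λ { refl → dx })
                      (subst (nodes <_) (+-suc (length (v ∷ us)) d) bound)
    ...   | yes (here x≡v) = contradiction (sym x≡v) (Adj-irr e)
    ...   | yes (there x∈us) with Path-prefix p x∈us
    ...     | .(x ∷ []) , qs , us≡ , (_ ∷ []) = contradiction dx (no-return (from us≡))
    ...     | a ∷ b ∷ ps , qs , refl , q =
              contradiction (Adj-sym e) (no-cycle q (Unique-++⁻ˡ (v ∷ a ∷ b ∷ ps) u) (s≤s (s≤s z≤n)))
    ...     | [] , qs , us≡ , [] = contradiction refl (Adj-irr e)

  -- As in `reachAvoid`, only the nodes after the first have to avoid `t`.
  Conn : Node → Node → Node → Set
  Conn t = Star (λ u v → Adj u v × v ≢ t)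

  Conn-≢ : ∀ {t x y} → x ≢ t → Conn t x y → y ≢ t
  Conn-≢ x≢t ε = x≢t
  Conn-≢ x≢t ((_ , ≢t) ◅ c) = Conn-≢ ≢t c

  Conn-sym : ∀ {t x y} → x ≢ t → Conn t x y → Conn t y x
  Conn-sym x≢t ε = ε
  Conn-sym x≢t ((e , ≢t) ◅ c) = Conn-sym ≢t c ◅◅ (Adj-sym e , x≢t) ◅ ε

  Path-≢ : ∀ {t x ps z} → x ≢ t → Path (λ u v → Adj u v × v ≢ t) x ps z → All (t ≢_) (x ∷ ps)
  Path-≢ x≢t [] = (x≢t ∘ sym) ∷ []
  Path-≢ x≢t ((_ , y≢t) ∷ p) = (x≢t ∘ sym) ∷ Path-≢ y≢t p

  -- A simple path avoiding `t` between two distinct neighbours of `t` would close up through `t` to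
  -- a cycle.
  neighbours-apart : ∀ {t x z} → Adj t x → Adj t z → Conn t x z → x ≡ z
  neighbours-apart {t} {x} {z} ex ez c with simple-path c
  ... | [] , [] , _ = refl
  ... | _ ∷ _ , p , u =
    contradiction (Adj-sym ez)
      (no-cycle (ex ∷ Path-map proj₁ p) (Path-≢ (Adj-irr ex ∘ sym) p ∷ u) (s≤s (s≤s z≤n)))

  -- Induction along a walk from `y` to `x`: a prepended node inherits the side unless it is an end
  -- of the edge, and then it lies on its own side.
  side : ∀ {t x} → Adj x t → ∀ y → Conn t x y ⊎ Conn x t y
  side {t} {x} e y = go (connected y x)
    where
    go : ∀ {y} → Walk adj y x → Conn t x y ⊎ Conn x t y
    go here = inj₁ ε
    go {y} (step e′ w) with go w | y ≟ t | y ≟ x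
    ... | inj₁ _ | yes refl | _ = inj₂ ε
    ... | inj₁ c | no y≢t | _ = inj₁ (c ◅◅ (Adj-sym e′ , y≢t) ◅ ε)
    ... | inj₂ _ | _ | yes refl = inj₁ ε
    ... | inj₂ c | _ | no y≢x = inj₂ (c ◅◅ (Adj-sym e′ , y≢x) ◅ ε)

  -- Cut the walk from `t` to `y` at its last visit to `t`. Unless `y` is `t`, it leaves through a
  -- neighbour `z` other than `x`, and then `x` and `z` are joined avoiding `t`.
  one-side : ∀ {t x y} → Adj x t → Conn t x y → ¬ Conn x t y
  one-side {t} {x} {y} e c c′ with [ leave , id ]′ (last-visit c′)
    where
    Avoid : Node → Node → Set
    Avoid u v = Adj u v × v ≢ x × v ≢ t
    Exit : Set
    Exit = y ≡ t ⊎ (∃[ z ] Adj t z × z ≢ x × Conn t z y)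
    leave : Star Avoid t y → Exit
    leave ε = inj₁ refl
    leave ((e′ , z≢x , _) ◅ w) = inj₂ (_ , e′ , z≢x , Star-map (λ { (a , _ , b) → a , b }) w)
    last-visit : ∀ {w} → Conn x w y → Star Avoid w y ⊎ Exit
    last-visit ε = inj₁ ε
    last-visit (_◅_ {j = w′} (e′ , w′≢x) w) with last-visit w | w′ ≟ t
    ... | inj₂ exit | _ = inj₂ exit
    ... | inj₁ a | yes refl = inj₂ (leave a)
    ... | inj₁ a | no w′≢t = inj₁ ((e′ , w′≢x , w′≢t) ◅ a)
  ... | inj₁ refl = contradiction refl (Conn-≢ (Adj-irr e) c)
  ... | inj₂ (z , e′ , z≢x , d) =
    z≢x (sym (neighbours-apart (Adj-sym e) e′ (c ◅◅ Conn-sym (Adj-irr e′ ∘ sym) d)))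

  reach-mono : ∀ {t x y} i j → T (reachAvoid Tr t j x y) → T (reachAvoid Tr t (i + j) x y)
  reach-mono zero j h = h
  reach-mono (suc i) j h = Equivalence.from Boolₚ.T-∨ (inj₁ (reach-mono i j h))

  reach-sound : ∀ {t x y} j → T (reachAvoid Tr t j x y) → Conn t x y
  reach-sound {t} {x} {y} zero h with toWitness {a? = x ≟ y} h
  ... | refl = ε
  reach-sound {t} {x} {y} (suc j) h with Equivalence.to (Boolₚ.T-∨ {reachAvoid Tr t j x y}) h
  ... | inj₁ h′ = reach-sound j h′
  ... | inj₂ h′ with satisfied (any⁻ _ (allFin nodes) h′)
  ...   | z , hz with Equivalence.to (Boolₚ.T-∧ {reachAvoid Tr t j x z}) hz
  ...     | c , hz′ with Equivalence.to (Boolₚ.T-∧ {adj z y}) hz′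
  ...       | e , ≢t = reach-sound j c ◅◅ (e , toWitnessFalse {a? = y ≟ t} ≢t) ◅ ε

  reach-complete : ∀ {t x u ps z} j → T (reachAvoid Tr t j x u) →
                   Path (λ u v → Adj u v × v ≢ t) u ps z → T (reachAvoid Tr t (length ps + j) x z)
  reach-complete j h [] = h
  reach-complete {t} {x} {u} {y ∷ ps} {z} j h ((e , y≢t) ∷ p) =
    subst (λ i → T (reachAvoid Tr t i x z)) (+-suc (length ps) j) (reach-complete (suc j) h′ p)
    where
    h′ : T (reachAvoid Tr t (suc j) x y)
    h′ = Equivalence.from (Boolₚ.T-∨ {reachAvoid Tr t j x y}) (inj₂ (any⁺ _ (lose (∈-allFin u)
           (Equivalence.from Boolₚ.T-∧ (h , Equivalence.from (Boolₚ.T-∧ {adj u y}) (e , fromWitnessFalse y≢t))))))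

  -- The fuel `nodes` is enough because a simple path has at most that many nodes.
  sameComp⇔Conn : ∀ {t x y} → T (sameComp Tr t x y) ⇔ Conn t x y
  sameComp⇔Conn {t} {x} {y} = mk⇔ (reach-sound nodes) to
    where
    to : Conn t x y → T (sameComp Tr t x y)
    to c with simple-path c
    ... | ps , p , u = subst (λ j → T (reachAvoid Tr t j x y)) (m∸n+n≡m bound)
        (reach-mono (nodes ∸ length ps) (length ps)
          (subst (λ j → T (reachAvoid Tr t j x y)) (+-identityʳ (length ps))
            (reach-complete 0 (fromWitness {a? = x ≟ x} refl) p)))
      where
      bound : length ps ≤ nodes
      bound = ≤-trans (n≤1+n _) (subst (length (x ∷ ps) ≤_) (length-tabulate id)
                (Unique-length u (λ _ → ∈-allFin _)))

  -- Edge labellings and the tree-decompositions they come from.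

  -- `α x t` is the part lying behind `x` as seen from `t`. Disjointness is required per edge, not
  -- per label, so several edges at a node may carry `∅`.
  record Labelling (n : ℕ) : Set where
    field
      α        : Node → Node → Subset n
      α-inv    : ∀ {x y} → Adj x y → α y x ≡ ∁ (α x y)
      disjoint : ∀ {t x y} → Adj t x → Adj t y → x ≢ y → Disj (α x t) (α y t)

  component : ∀ {n} → (Fin n → Node) → Node → Node → Subset n
  component τ x t = tabulate (λ e → sameComp Tr t x (τ e))

  ∈-component : ∀ {n} (τ : Fin n → Node) {x t e} → e ∈ˢ component τ x t ⇔ Conn t x (τ e)
  ∈-component τ = mk⇔ (Equivalence.to sameComp⇔Conn ∘ Equivalence.to (∈-tabulate _))
                      (Equivalence.from (∈-tabulate _) ∘ Equivalence.from sameComp⇔Conn)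

  component-labelling : ∀ {n} → (Fin n → Node) → Labelling n
  component-labelling {n} τ = record
    { α = component τ
    ; α-inv = λ {x} {y} e → ⊆-antisym
        (λ h → x∉p⇒x∈∁p (λ h′ → one-side e (to h′) (to h)))
        (λ {i} h → [ (λ c → contradiction (from c) (x∈∁p⇒x∉p h)) , from ]′ (side e (τ i)))
    ; disjoint = λ ex ey x≢y h → x∉p⇒x∈∁p (λ h′ →
        x≢y (neighbours-apart ex ey (to h ◅◅ Conn-sym (Adj-irr ey ∘ sym) (to h′))))
    }
    where
    to : ∀ {x t e} → e ∈ˢ component τ x t → Conn t x (τ e)
    to = Equivalence.to (∈-component τ)
    from : ∀ {x t e} → Conn t x (τ e) → e ∈ˢ component τ x t
    from = Equivalence.from (∈-component τ)

  module _ {n : ℕ} (L : Labelling n) where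
    open Labelling L

    -- All edges at y are oriented by e towards y.
    Home : Fin n → Node → Set
    Home e y = ∀ {z} → Adj y z → e ∉ˢ α z y

    -- Let `e` direct every edge towards the part containing it. Labels of opposite directions are
    -- complementary, so no step turns back and `sink` yields a home.
    home : Node → ∀ e → ∃ (Home e)
    home start e = sink (Home e) (λ t x → Adj t x × e ∈ˢ α x t) next no-return start
      where
      next : ∀ t → Home e t ⊎ ∃[ x ] Adj t x × Adj t x × e ∈ˢ α x t
      next t with Finₚ.any? (λ x → Boolₚ.T? (adj t x) ×-dec (e ∈ˢ? α x t))
      ... | yes (x , a , h) = inj₂ (x , a , a , h)
      ... | no none = inj₁ (λ {z} a h → none (z , a , h))
      no-return : ∀ {t x} → Adj t x × e ∈ˢ α x t → ¬ (Adj x t × e ∈ˢ α t x)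
      no-return (a , h) (_ , h′) = x∈∁p⇒x∉p (subst (e ∈ˢ_) (α-inv a) h) h′

    -- Every edge points towards the home of `e`: this holds for edges at the home, and disjointness
    -- at each node carries it one edge further along a path.
    α≡component : (τ : Fin n → Node) → (∀ e → Home e (τ e)) → ∀ {x t} → Adj t x → α x t ≡ component τ x t
    α≡component τ homes {x} {t} a = ⊆-antisym
      (λ {e} h → [ Equivalence.from (∈-component τ)
                 , (λ c → contradiction h (x∈∁p⇒x∉p (subst (e ∈ˢ_) (α-inv (Adj-sym a)) (∈α (Adj-sym a) c)))) ]′
                   (side (Adj-sym a) (τ e)))
      (∈α a ∘ Equivalence.to (∈-component τ))
      where
      along : ∀ {e t x ps} → Adj t x → Path Adj x ps (τ e) → Unique (t ∷ x ∷ ps) → e ∈ˢ α x t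
      along {e} {t} {x} a [] _ = subst (e ∈ˢ_) (sym (α-inv a)) (x∉p⇒x∈∁p (homes e (Adj-sym a)))
      along {e} {t} {x} a (a′ ∷ p) ((_ ∷ t≢y ∷ _) ∷ u) =
        subst (e ∈ˢ_) (sym (α-inv a)) (x∉p⇒x∈∁p (e∉αtx (along a′ p u)))
        where
        e∉αtx : e ∈ˢ α _ x → e ∉ˢ α t x
        e∉αtx h h′ = x∈∁p⇒x∉p (disjoint (Adj-sym a) a′ t≢y h′) h
      ∈α : ∀ {e t x} → Adj t x → Conn t x (τ e) → e ∈ˢ α x t
      ∈α a c with simple-path c
      ... | ps , p , u = along a (Path-map proj₁ p) (Path-≢ (Adj-irr a ∘ sym) p ∷ u)

-- Cycles, and trees grown leaf by leaf.

least-element : ∀ {m} (x : Fin m) xs → ∃[ z ] z ∈ x ∷ xs × (∀ {y} → y ∈ x ∷ xs → toℕ z ≤ toℕ y)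
least-element x [] = x , here refl , λ { (here refl) → ≤-refl }
least-element x (y ∷ xs) with least-element y xs
... | z , z∈ , least with ≤-total (toℕ x) (toℕ z)
...   | inj₁ x≤z = x , here refl , λ { (here refl) → ≤-refl ; (there w∈) → ≤-trans x≤z (least w∈) }
...   | inj₂ z≤x = z , there z∈ , λ { (here refl) → z≤x ; (there w∈) → least w∈ }

module _ {A : Set} {R : A → A → Set} where

  Linked-last : ∀ c cs {x} → Linked R (c ∷ cs ++ x ∷ []) → ∃[ b ] b ∈ c ∷ cs × R b x
  Linked-last c [] (e ∷ _) = c , here refl , e
  Linked-last c (d ∷ cs) (_ ∷ l) with Linked-last d cs l
  ... | b , b∈ , e = b , there b∈ , e

  -- The second alternative is for the last entry `z`, followed by the closing `x`. Its predecessor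
  -- is `p` only if `z` is the sole entry, which the length bound in `cycle-neighbours` rules out.
  Linked-neighbours : ∀ {x z} p ys → Linked R (p ∷ ys ++ x ∷ []) → Unique (p ∷ ys) → z ∈ ys →
    (∃[ a ] ∃[ b ] a ∈ ys × b ∈ p ∷ ys × a ≢ b × R z a × R b z)
    ⊎ (R z x × ∃[ b ] R b z × (b ∈ ys ⊎ ys ≡ [ z ] × b ≡ p))
  Linked-neighbours p (y ∷ []) (e ∷ e′ ∷ _) _ (here refl) = inj₂ (e′ , p , e , inj₂ (refl , refl))
  Linked-neighbours p (y ∷ a ∷ ys) (e ∷ e′ ∷ _) ((_ ∷ p≢a ∷ _) ∷ _) (here refl) =
    inj₁ (a , p , there (here refl) , here refl , p≢a ∘ sym , e′ , e)
  Linked-neighbours p (y ∷ ys) (_ ∷ l) (_ ∷ u) (there z∈) with Linked-neighbours y ys l u z∈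
  ... | inj₁ (a , b , a∈ , b∈ , rest) = inj₁ (a , b , there a∈ , there b∈ , rest)
  ... | inj₂ (e , b , e′ , inj₁ b∈) = inj₂ (e , b , e′ , inj₁ (there b∈))
  ... | inj₂ (e , b , e′ , inj₂ (_ , refl)) = inj₂ (e , b , e′ , inj₁ (here refl))

  cycle-neighbours : ∀ {x xs z} → 2 ≤ length xs → Unique (x ∷ xs) → Linked R (x ∷ xs ++ x ∷ []) → z ∈ x ∷ xs →
    ∃[ a ] ∃[ b ] a ∈ x ∷ xs × b ∈ x ∷ xs × a ≢ b × R z a × R b z
  cycle-neighbours {xs = _ ∷ []} (s≤s ()) _ _ (here _)
  cycle-neighbours {xs = a ∷ c ∷ cs} _ (_ ∷ a∉ ∷ _) (e ∷ _ ∷ l) (here refl) with Linked-last c cs l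
  ... | b , b∈ , e′ = a , b , there (here refl) , there (there b∈) , All.lookup a∉ b∈ , e , e′
  cycle-neighbours {x} {xs} 2≤ u@(x∉ ∷ _) l (there z∈) with Linked-neighbours x xs l u z∈
  ... | inj₁ (a , b , a∈ , b∈ , rest) = a , b , there a∈ , b∈ , rest
  ... | inj₂ (e , b , e′ , inj₁ b∈) = x , b , here refl , there b∈ , All.lookup x∉ b∈ , e , e′
  cycle-neighbours (s≤s ()) _ _ (there z∈) | inj₂ (e , b , e′ , inj₂ (refl , _))

-- Trees built by attaching leaves: the newest node is zero, and the label of an
-- attached leaf is the part of the ground set on its side of the new edge.
data GrownTree (n : ℕ) : ℕ → Set where
  root   : GrownTree n 1
  attach : ∀ {m} → GrownTree n m → Fin m → Subset n → GrownTree n (suc m)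

module _ {n : ℕ} where

  gadj : ∀ {m} → GrownTree n m → Fin m → Fin m → Bool
  gadj root _ _ = false
  gadj (attach G v X) zero zero = false
  gadj (attach G v X) zero (suc j) = ⌊ v ≟ j ⌋
  gadj (attach G v X) (suc i) zero = ⌊ v ≟ i ⌋
  gadj (attach G v X) (suc i) (suc j) = gadj G i j

  glabel : ∀ {m} → GrownTree n m → Fin m → Fin m → Subset n
  -- There are no edges yet; `∅` is a placeholder.
  glabel root _ _ = ∅
  glabel (attach G v X) zero _ = X
  glabel (attach G v X) (suc i) zero = ∁ X
  glabel (attach G v X) (suc i) (suc j) = glabel G i j

  -- A recursive form of `neighbours`, equal to it up to order, in which attaching a leaf puts one
  -- entry in front.
  gneighbours : ∀ {m} → GrownTree n m → Fin m → List (Fin m)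
  gneighbours root _ = []
  gneighbours (attach G v X) zero = [ suc v ]
  gneighbours (attach G v X) (suc i) with v ≟ i
  ... | yes _ = zero ∷ map suc (gneighbours G i)
  ... | no _ = map suc (gneighbours G i)

  gstar : ∀ {m} → GrownTree n m → Fin m → List (Subset n)
  gstar G t = map (λ x → glabel G x t) (gneighbours G t)

  gstar-at : ∀ {m} (G : GrownTree n m) v X → gstar (attach G v X) (suc v) ≡ X ∷ gstar G v
  gstar-at G v X with v ≟ v
  ... | yes _ = cong (X ∷_) (sym (map-∘ (gneighbours G v)))
  ... | no v≢v = contradiction refl v≢v

  gstar-away : ∀ {m} (G : GrownTree n m) {v t} X → t ≢ v → gstar (attach G v X) (suc t) ≡ gstar G t
  gstar-away G {v} {t} X t≢v with v ≟ t
  ... | yes v≡t = contradiction (sym v≡t) t≢v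
  ... | no _ = sym (map-∘ (gneighbours G t))

  gneighbours⇔gadj : ∀ {m} (G : GrownTree n m) {t x} → x ∈ gneighbours G t ⇔ T (gadj G t x)
  gneighbours⇔gadj G = mk⇔ (to G) (from G)
    where
    to : ∀ {m} (G : GrownTree n m) {t x} → x ∈ gneighbours G t → T (gadj G t x)
    to (attach G v X) {zero} (here refl) = fromWitness {a? = v ≟ v} refl
    to (attach G v X) {suc i} x∈ with v ≟ i
    to (attach G v X) {suc i} (here refl) | yes refl = fromWitness {a? = v ≟ v} refl
    to (attach G v X) {suc i} (there x∈) | yes _ with ∈-map⁻ suc x∈
    ... | _ , y∈ , refl = to G y∈
    to (attach G v X) {suc i} x∈ | no _ with ∈-map⁻ suc x∈
    ... | _ , y∈ , refl = to G y∈
    from : ∀ {m} (G : GrownTree n m) {t x} → T (gadj G t x) → x ∈ gneighbours G t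
    from (attach G v X) {zero} {suc j} h with toWitness {a? = v ≟ j} h
    ... | refl = here refl
    from (attach G v X) {suc i} {zero} h with v ≟ i
    ... | yes _ = here refl
    from (attach G v X) {suc i} {suc j} h with v ≟ i
    ... | yes _ = there (∈-map⁺ suc (from G h))
    ... | no _ = ∈-map⁺ suc (from G h)

  gneighbours-unique : ∀ {m} (G : GrownTree n m) t → Unique (gneighbours G t)
  gneighbours-unique root t = []
  gneighbours-unique (attach G v X) zero = [] ∷ []
  gneighbours-unique (attach G v X) (suc i) with v ≟ i
  ... | yes _ = All.tabulate (λ y∈ → λ { refl → zero∉ (∈-map⁻ suc y∈) })
                ∷ Uniqueₚ.map⁺ Finₚ.suc-injective (gneighbours-unique G i)
    where
    zero∉ : ∃[ y ] y ∈ gneighbours G i × zero ≡ suc y → ⊥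
    zero∉ (_ , _ , ())
  ... | no _ = Uniqueₚ.map⁺ Finₚ.suc-injective (gneighbours-unique G i)

  gadj-sym : ∀ {m} (G : GrownTree n m) x y → gadj G x y ≡ gadj G y x
  gadj-sym root _ _ = refl
  gadj-sym (attach G v X) zero zero = refl
  gadj-sym (attach G v X) zero (suc j) = refl
  gadj-sym (attach G v X) (suc i) zero = refl
  gadj-sym (attach G v X) (suc i) (suc j) = gadj-sym G i j

  gadj-irr : ∀ {m} (G : GrownTree n m) x → gadj G x x ≡ false
  gadj-irr root _ = refl
  gadj-irr (attach G v X) zero = refl
  gadj-irr (attach G v X) (suc i) = gadj-irr G i

  -- Older nodes have larger indices, and a node is attached to exactly one of them.
  older-neighbour-unique : ∀ {m} (G : GrownTree n m) {t a b} → T (gadj G t a) → T (gadj G t b) →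
                           toℕ t < toℕ a → toℕ t < toℕ b → a ≡ b
  older-neighbour-unique (attach G v X) {zero} {suc a} {suc b} ea eb _ _ =
    cong suc (trans (sym (toWitness {a? = v ≟ a} ea)) (toWitness {a? = v ≟ b} eb))
  older-neighbour-unique (attach G v X) {suc t} {suc a} {suc b} ea eb (s≤s la) (s≤s lb) =
    cong suc (older-neighbour-unique G ea eb la lb)

  -- The newest node on a cycle would have two distinct older neighbours.
  gacyclic : ∀ {m} (G : GrownTree n m) → ¬ HasCycle (gadj G)
  gacyclic G (x , xs , 2≤ , u , l) with least-element x xs
  ... | z , z∈ , least with cycle-neighbours 2≤ u l z∈
  ...   | a , b , a∈ , b∈ , a≢b , ea , eb = a≢b (older-neighbour-unique G ea eb′ (above a∈ ea) (above b∈ eb′))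
    where
    eb′ : T (gadj G z b)
    eb′ = subst T (gadj-sym G b z) eb
    above : ∀ {y} → y ∈ x ∷ xs → T (gadj G z y) → toℕ z < toℕ y
    above y∈ e = ≤∧≢⇒< (least y∈) (λ z≡y → subst T (gadj-irr G z)
                   (subst (T ∘ gadj G z) (sym (Finₚ.toℕ-injective z≡y)) e))

  gwalk-suc : ∀ {m} {G : GrownTree n m} {v X x y} → Walk (gadj G) x y → Walk (gadj (attach G v X)) (suc x) (suc y)
  gwalk-suc here = here
  gwalk-suc (step e w) = step e (gwalk-suc w)

  gwalk-snoc : ∀ {m} {adj : Fin m → Fin m → Bool} {x y z} → Walk adj x y → T (adj y z) → Walk adj x z
  gwalk-snoc here e = step e here
  gwalk-snoc (step e′ w) e = step e′ (gwalk-snoc w e)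

  gconnected : ∀ {m} (G : GrownTree n m) x y → Walk (gadj G) x y
  gconnected root zero zero = here
  gconnected (attach G v X) zero zero = here
  gconnected (attach G v X) zero (suc j) =
    step {y = suc v} (fromWitness {a? = v ≟ v} refl) (gwalk-suc (gconnected G v j))
  gconnected (attach G v X) (suc i) zero =
    gwalk-snoc {y = suc v} (gwalk-suc (gconnected G i v)) (fromWitness {a? = v ≟ v} refl)
  gconnected (attach G v X) (suc i) (suc j) = gwalk-suc (gconnected G i j)

  gtree : ∀ {m} → GrownTree n m → Tree
  gtree {m} G = record
    { nodes = m
    ; nonempty = nonempty G
    ; adj = gadj G
    ; adj-sym = gadj-sym G
    ; adj-irr = gadj-irr G
    ; connected = gconnected G
    ; acyclic = gacyclic G
    }
    where
    nonempty : ∀ {m} → GrownTree n m → 1 ≤ m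
    nonempty root = s≤s z≤n
    nonempty (attach _ _ _) = s≤s z≤n

  glabel-inv : ∀ {m} (G : GrownTree n m) {x y} → T (gadj G x y) → glabel G y x ≡ ∁ (glabel G x y)
  glabel-inv (attach G v X) {zero} {suc j} e = refl
  glabel-inv (attach G v X) {suc i} {zero} e = sym (∁-involutive X)
  glabel-inv (attach G v X) {suc i} {suc j} e = glabel-inv G e

-- Turning a conflict into a tree.

module Growth {n : ℕ} (M : Matroid n) (k : ℕ) where
  open Duality M k

  -- Old stars may still be incomplete, so only the new nodes are required to be `Good`.
  record Extension {m : ℕ} (G : GrownTree n m) (v : Fin m) (Ys : List (Subset n)) : Set where
    field
      size   : ℕ
      result : GrownTree n size
      ι      : Fin m → Fin size
      ι-inj  : ∀ {s t} → ι s ≡ ι t → s ≡ t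
      at     : gstar result (ι v) ↭ Ys ++ gstar G v
      away   : ∀ {t} → t ≢ v → gstar result (ι t) ≡ gstar G t
      new    : ∀ u → (∃[ t ] ι t ≡ u) ⊎ Good (gstar result u)

  open Extension

  -- With no leaves available the branch is a node: attach a leaf labelled `X` at `v` and grow the
  -- children there. Its star is then `Xs` with `∁ X` from the edge back to `v`.
  extend  : ∀ {X} → Br [] X → ∀ {m} (G : GrownTree n m) v → Extension G v [ X ]
  extends : ∀ {Xs} → All (Br []) Xs → ∀ {m} (G : GrownTree n m) v → Extension G v Xs
  extend {X} (node Xs brs good) G v = record
    { size = size E
    ; result = result E
    ; ι = ι E ∘ suc
    ; ι-inj = Finₚ.suc-injective ∘ ι-inj E
    ; at = ↭-reflexive (trans (away E (λ ())) (gstar-at G v X))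
    ; away = λ t≢v → trans (away E (λ ())) (gstar-away G X t≢v)
    ; new = new′
    }
    where
    E : Extension (attach G v X) zero Xs
    E = extends brs (attach G v X) zero
    new′ : ∀ u → (∃[ t ] ι E (suc t) ≡ u) ⊎ Good (gstar (result E) u)
    new′ u with new E u
    ... | inj₁ (zero , refl) = inj₂ (Good-↭ (↭-sym (↭-trans (at E) (++-comm Xs _))) good)
    ... | inj₁ (suc t , ιt≡u) = inj₁ (t , ιt≡u)
    ... | inj₂ g = inj₂ g
  extends [] {m} G v = record
    { size = m ; result = G ; ι = id ; ι-inj = id ; at = ↭-refl ; away = λ _ → refl ; new = λ u → inj₁ (u , refl) }
  extends {X ∷ Xs} (br ∷ brs) {m} G v = record
    { size = size E₂
    ; result = result E₂
    ; ι = ι E₂ ∘ ι E₁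
    ; ι-inj = ι-inj E₁ ∘ ι-inj E₂
    ; at = ↭-trans (at E₂) (↭-trans (++⁺ˡ Xs (at E₁)) (shift X Xs (gstar G v)))
    ; away = λ t≢v → trans (away E₂ (t≢v ∘ ι-inj E₁)) (away E₁ t≢v)
    ; new = new′
    }
    where
    E₁ : Extension G v [ X ]
    E₁ = extend br G v
    E₂ : Extension (result E₁) (ι E₁ v) Xs
    E₂ = extends brs (result E₁) (ι E₁ v)
    new′ : ∀ u → (∃[ t ] ι E₂ (ι E₁ t) ≡ u) ⊎ Good (gstar (result E₂) u)
    new′ u with new E₂ u
    ... | inj₂ g = inj₂ g
    ... | inj₁ (w , refl) with w ≟ ι E₁ v | new E₁ w
    ...   | yes refl | _ = inj₁ (v , refl)
    ...   | no _ | inj₁ (t , refl) = inj₁ (t , refl)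
    ...   | no w≢ | inj₂ g = inj₂ (subst Good (sym (away E₂ w≢)) g)

  -- The root star of the tree for `X` is placed at the first node, and its member `∁ X` is filled
  -- by the other tree.
  Conflict⇒GrownTree : Conflict [] → ∃[ m ] Σ (GrownTree n m) λ G → (∀ t → Good (gstar G t)) × HasEdge (gtree G)
  Conflict⇒GrownTree (X , node Xs brs good , br∁X) = size E , result E , all-good , edge
    where
    E : Extension root zero (∁ X ∷ Xs)
    E = extends (br∁X ∷ brs) root zero
    all-good : ∀ t → Good (gstar (result E) t)
    all-good t with new E t
    ... | inj₂ g = g
    ... | inj₁ (zero , refl) = Good-↭ (↭-sym (↭-trans (at E) (↭-reflexive (++-identityʳ _)))) good
    edge : HasEdge (gtree (result E))
    edge with gneighbours (result E) (ι E zero) in eq | ↭-length (at E)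
    ... | x ∷ _ | _ = ι E zero , x , Equivalence.to (gneighbours⇔gadj (result E)) (subst (x ∈_) (sym eq) (here refl))

-- Integer inequalities and lists of neighbours.

+-<⇔ : ∀ {a b k} → (+ a ℤ.- + b ℤ.< + k) ⇔ (a < k + b)
+-<⇔ {a} {b} {k} = mk⇔
  (λ h → ℤₚ.drop‿+<+ (subst (ℤ._< + (k + b)) (cancel a) (ℤₚ.+-monoˡ-< (+ b) h)))
  (λ h → subst (+ a ℤ.- + b ℤ.<_) cancel′ (ℤₚ.+-monoˡ-< (ℤ.- + b) (+<+ h)))
  where
  cancel : ∀ c → + c ℤ.- + b ℤ.+ + b ≡ + c
  cancel c = trans (ℤₚ.+-assoc (+ c) (ℤ.- + b) (+ b))
    (trans (cong (λ i → + c ℤ.+ i) (ℤₚ.+-inverseˡ (+ b))) (ℤₚ.+-identityʳ (+ c)))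
  cancel′ : + (k + b) ℤ.- + b ≡ + k
  cancel′ = trans (ℤₚ.+-assoc (+ k) (+ b) (ℤ.- + b))
    (trans (cong (λ i → + k ℤ.+ i) (ℤₚ.+-inverseʳ (+ b))) (ℤₚ.+-identityʳ (+ k)))

-- One further `b` on both sides turns the factor `length ∸ 1` of a norm into the full length used
-- in `Good`.
+-*-<⇔ : ∀ {a m b k} → (+ a ℤ.- (+ m ℤ.* + b) ℤ.< + k) ⇔ (a + b < k + suc m * b)
+-*-<⇔ {a} {m} {b} {k} = mk⇔
  (λ h → subst (a + b <_) (arrange k (m * b) b)
           (+-monoˡ-< b (Equivalence.to +-<⇔ (subst (λ i → + a ℤ.- i ℤ.< + k) (sym (ℤₚ.pos-* m b)) h))))
  (λ h → subst (λ i → + a ℤ.- i ℤ.< + k) (ℤₚ.pos-* m b)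
           (Equivalence.from +-<⇔ (+-cancelʳ-< b a _ (subst (a + b <_) (sym (arrange k (m * b) b)) h))))
  where
  arrange : ∀ k c b → k + c + b ≡ k + (b + c)
  arrange = solve-∀

Unique⇒AllPairs : ∀ {A : Set} {R : A → A → Set} {xs} → Unique xs →
                  (∀ {x y} → x ∈ xs → y ∈ xs → x ≢ y → R x y) → AllPairs R xs
Unique⇒AllPairs [] f = []
Unique⇒AllPairs (x∉ ∷ u) f =
  All.tabulate (λ y∈ → f (here refl) (there y∈) (All.lookup x∉ y∈))
  ∷ Unique⇒AllPairs u (λ x∈ y∈ → f (there x∈) (there y∈))

AllPairs-lookup : ∀ {A : Set} {R : A → A → Set} → (∀ {x y} → R x y → R y x) → ∀ {xs} → AllPairs R xs →
                  ∀ {x y} → x ∈ xs → y ∈ xs → x ≢ y → R x y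
AllPairs-lookup sm (_ ∷ _) (here refl) (here refl) x≢y = contradiction refl x≢y
AllPairs-lookup sm (d ∷ _) (here refl) (there y∈) _ = All.lookup d y∈
AllPairs-lookup sm (d ∷ _) (there x∈) (here refl) _ = sm (All.lookup d x∈)
AllPairs-lookup sm (_ ∷ ds) (there x∈) (there y∈) x≢y = AllPairs-lookup sm ds x∈ y∈ x≢y

∈-neighbours : ∀ Tr {t x} → x ∈ neighbours Tr t ⇔ T (Tree.adj Tr t x)
∈-neighbours Tr {t} {x} = mk⇔ (proj₂ ∘ ∈-filter⁻ P? {xs = allFin _}) (∈-filter⁺ P? {xs = allFin _} (∈-allFin x))
  where
  P? : ∀ y → Dec (T (Tree.adj Tr t y))
  P? = Boolₚ.T? ∘ Tree.adj Tr t

neighbours-unique : ∀ Tr t → Unique (neighbours Tr t)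
neighbours-unique Tr t = Uniqueₚ.filter⁺ (Boolₚ.T? ∘ Tree.adj Tr t) (Uniqueₚ.allFin⁺ (Tree.nodes Tr))

gneighbours↭neighbours : ∀ {n m} (G : GrownTree n m) t → gneighbours G t ↭ neighbours (gtree G) t
gneighbours↭neighbours G t = ∼bag⇒↭ (unique∧set⇒bag (gneighbours-unique G t) (neighbours-unique (gtree G) t)
  (mk⇔ (Equivalence.from (∈-neighbours (gtree G)) ∘ Equivalence.to (gneighbours⇔gadj G))
       (Equivalence.from (gneighbours⇔gadj G) ∘ Equivalence.to (∈-neighbours (gtree G)))))

-- Translation to stars, norms and widths.

module Main {n : ℕ} (M : Matroid n) (k : ℕ) (0<k : 0 < k) where
  open Matroid M
  open Duality M k
  open Growth M k
  open DecMembership (_≟ˢ_ {n}) using (_∈?_)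
  open TreeTheory using (Labelling; component)

  Low : List (Subset n) → Set
  Low σ = co σ + R < k + length σ * R

  InSk⇔Small : ∀ {X} → InSk M k X ⇔ Small X
  InSk⇔Small = +-<⇔

  norm<⇔Low : ∀ X σ → (norm M k (X ∷ σ) ℤ.< + k) ⇔ Low (X ∷ σ)
  norm<⇔Low X σ = +-*-<⇔ {m = length σ}

  Small-∁⁻ : ∀ {X} → Small (∁ X) → Small X
  Small-∁⁻ {X} = subst (_< k + R) (s-∁ X)

  InF⇒Good : ∀ {X σ} → InF M k (X ∷ σ) → Good (X ∷ σ)
  InF⇒Good {X} {σ} (u , (_ , star) , low) =
    Unique⇒AllPairs u (λ x∈ y∈ x≢y → proj₁ (star _ _ x∈ y∈ x≢y)) , Equivalence.to (norm<⇔Low X σ) low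

  -- Stars in `InF` are duplicate-free, whereas the labels at a node may repeat `∅`.
  nub : List (Subset n) → List (Subset n)
  nub [] = []
  nub (X ∷ σ) with X ∈? nub σ
  ... | yes _ = nub σ
  ... | no _ = X ∷ nub σ

  nub-unique : ∀ σ → Unique (nub σ)
  nub-unique [] = []
  nub-unique (X ∷ σ) with X ∈? nub σ
  ... | yes _ = nub-unique σ
  ... | no X∉ = ¬Any⇒All¬ (nub σ) X∉ ∷ nub-unique σ

  ∈-nub : ∀ {X} σ → X ∈ nub σ ⇔ X ∈ σ
  ∈-nub σ = mk⇔ (to σ) (from σ)
    where
    to : ∀ {X} σ → X ∈ nub σ → X ∈ σ
    to (Y ∷ σ) h with Y ∈? nub σ
    to (Y ∷ σ) h | yes _ = there (to σ h)
    to (Y ∷ σ) (here refl) | no _ = here refl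
    to (Y ∷ σ) (there h) | no _ = there (to σ h)
    from : ∀ {X} σ → X ∈ σ → X ∈ nub σ
    from (Y ∷ σ) h with Y ∈? nub σ
    from (Y ∷ σ) (here refl) | yes Y∈ = Y∈
    from (Y ∷ σ) (here refl) | no _ = here refl
    from (Y ∷ σ) (there h) | yes _ = from σ h
    from (Y ∷ σ) (there h) | no _ = there (from σ h)

  -- Only the empty set is disjoint from itself, and it contributes nothing to the norm.
  nub-co : ∀ {σ} → AllPairs Disj σ → co (nub σ) + length σ * R ≤ co σ + length (nub σ) * R
  nub-co [] = z≤n
  nub-co {X ∷ σ} (d ∷ ds) with X ∈? nub σ
  ... | yes X∈ = begin
        co (nub σ) + (R + length σ * R)          ≡⟨ arrange₁ (co (nub σ)) R (length σ * R) ⟩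
        R + (co (nub σ) + length σ * R)          ≤⟨ +-mono-≤ (r-mono full⊆∁X) (nub-co ds) ⟩
        r (∁ X) + (co σ + length (nub σ) * R)    ≡⟨ sym (+-assoc (r (∁ X)) (co σ) _) ⟩
        r (∁ X) + co σ + length (nub σ) * R      ∎
    where
    open ≤-Reasoning
    X⊆∁X : X ⊆ ∁ X
    X⊆∁X = All.lookup d (Equivalence.to (∈-nub σ) X∈)
    full⊆∁X : full ⊆ ∁ X
    full⊆∁X _ = x∉p⇒x∈∁p (λ x∈X → x∈∁p⇒x∉p (X⊆∁X x∈X) x∈X)
    arrange₁ : ∀ a b c → a + (b + c) ≡ b + (a + c)
    arrange₁ = solve-∀
  ... | no _ = begin
        r (∁ X) + co (nub σ) + (R + length σ * R)    ≡⟨ arrange₂ (r (∁ X)) (co (nub σ)) R (length σ * R) ⟩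
        r (∁ X) + R + (co (nub σ) + length σ * R)    ≤⟨ +-monoʳ-≤ (r (∁ X) + R) (nub-co ds) ⟩
        r (∁ X) + R + (co σ + length (nub σ) * R)    ≡⟨ arrange₂ (r (∁ X)) R (co σ) (length (nub σ) * R) ⟩
        r (∁ X) + co σ + (R + length (nub σ) * R)    ∎
    where
    open ≤-Reasoning
    arrange₂ : ∀ a b c d → a + b + (c + d) ≡ a + c + (b + d)
    arrange₂ = solve-∀

  nub-low : ∀ {σ} → Good σ → Low (nub σ)
  nub-low {σ} (ds , lt) = +-cancelʳ-< (length σ * R) _ _ (begin-strict
    co (nub σ) + R + length σ * R            ≡⟨ arrange (co (nub σ)) R (length σ * R) ⟩
    co (nub σ) + length σ * R + R            ≤⟨ +-monoˡ-≤ R (nub-co ds) ⟩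
    co σ + length (nub σ) * R + R            ≡⟨ arrange (co σ) (length (nub σ) * R) R ⟩
    co σ + R + length (nub σ) * R            <⟨ +-monoˡ-< (length (nub σ) * R) lt ⟩
    k + length σ * R + length (nub σ) * R    ≡⟨ arrange k (length σ * R) (length (nub σ) * R) ⟩
    k + length (nub σ) * R + length σ * R    ∎)
    where
    open ≤-Reasoning
    arrange : ∀ a b c → a + b + c ≡ a + c + b
    arrange = solve-∀

  nub-InF : ∀ {X σ} → X ∈ σ → Good σ → InF M k (nub σ)
  nub-InF {X} {σ} X∈σ good@(ds , _) = nub-unique σ , (nonempty , star) , low (nub σ) nonempty (nub-low good)
    where
    nonempty : nub σ ≢ []
    nonempty eq with nub σ | Equivalence.from (∈-nub σ) X∈σ
    nonempty refl | .[] | ()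
    star : ∀ a b → a ∈ nub σ → b ∈ nub σ → a ≢ b → a ≤S inv b
    star a b a∈ b∈ a≢b = a⊆∁b , p⊆q⇒∁p⊇∁q a⊆∁b
      where
      a⊆∁b : a ⊆ ∁ b
      a⊆∁b = AllPairs-lookup {R = Disj} ⊆∁-sym ds (Equivalence.to (∈-nub σ) a∈) (Equivalence.to (∈-nub σ) b∈) a≢b
    low : ∀ τ → τ ≢ [] → Low τ → norm M k τ ℤ.< + k
    low [] ne _ = contradiction refl ne
    low (Y ∷ τ) _ l = Equivalence.from (norm<⇔Low Y τ) l

  nodeWidth<⇔Low : (D : TreeDec n) → let open TreeDec D in ∀ t →
                   (nodeWidth M D t ℤ.< + k) ⇔ Low (map (λ x → component tree τ x t) (neighbours tree t))
  nodeWidth<⇔Low D t with neighbours (TreeDec.tree D) t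
  ... | [] = mk⇔ (subst (R <_) (sym (+-identityʳ k)) ∘ ℤₚ.drop‿+<+) (+<+ ∘ subst (R <_) (+-identityʳ k))
  ... | x ∷ ns =
    subst (λ a → (+ a ℤ.- (+ length ns ℤ.* + R) ℤ.< + k) ⇔ Low (F x ∷ map F ns))
      (cong sum (sym (map-∘ {g = λ X → r (∁ X)} {f = F} (x ∷ ns))))
      (subst (λ l → (+ c ℤ.- (+ length ns ℤ.* + R) ℤ.< + k) ⇔ (c + R < k + suc l * R))
        (sym (length-map F ns)) (+-*-<⇔ {m = length ns}))
    where
    F : Fin (Tree.nodes (TreeDec.tree D)) → Subset n
    F x = component (TreeDec.tree D) (TreeDec.τ D) x t
    c : ℕ
    c = co (F x ∷ map F ns)

  -- Low-norm labelled trees as S_k-trees and as tree-decompositions.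

  record LowTree : Set where
    field
      tree      : Tree
      labelling : Labelling tree n
    open Tree tree public
    open Labelling labelling public
    field
      low     : ∀ t → Low (map (λ x → α x t) (neighbours tree t))
      hasEdge : HasEdge tree

  -- `Good⇒Small` puts the labels into S_k. An edge and connectedness give every node a neighbour,
  -- so no star is empty.
  LowTree⇒SkTree : LowTree → SkTree M k
  LowTree⇒SkTree L = record
    { tree = tree
    ; hasEdge = hasEdge
    ; α = λ x y _ → α x y
    ; α-Sk = λ x y e → Equivalence.from InSk⇔Small (small (subst T (adj-sym x y) e))
    ; α-inv = λ x y e _ → α-inv e
    ; α-star = λ t → let (x , e) = neighbour t in
        nub (star t) , nub-InF (∈-map⁺ _ (Equivalence.from (∈-neighbours tree) e)) (good t) ,
        λ s → mk⇔ (to t ∘ Equivalence.to (∈-nub (star t))) (Equivalence.from (∈-nub (star t)) ∘ from t)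
    }
    where
    open LowTree L
    star : Fin nodes → List (Subset n)
    star t = map (λ x → α x t) (neighbours tree t)
    to : ∀ t {s} → s ∈ star t → Σ (Fin nodes) λ x → Σ (T (adj x t)) λ _ → α x t ≡ s
    to t s∈ with ∈-map⁻ _ s∈
    ... | x , x∈ , s≡ = x , subst T (adj-sym t x) (Equivalence.to (∈-neighbours tree) x∈) , sym s≡
    from : ∀ t {s} → (Σ (Fin nodes) λ x → Σ (T (adj x t)) λ _ → α x t ≡ s) → s ∈ star t
    from t (x , e , refl) = ∈-map⁺ _ (Equivalence.from (∈-neighbours tree) (subst T (adj-sym x t) e))
    good : ∀ t → Good (star t)
    good t = AllPairsₚ.map⁺ (Unique⇒AllPairs (neighbours-unique tree t) (λ x∈ y∈ x≢y →
               disjoint (Equivalence.to (∈-neighbours tree) x∈) (Equivalence.to (∈-neighbours tree) y∈) x≢y)) , low t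
    small : ∀ {x t} → T (adj t x) → Small (α x t)
    small {x} {t} e with ∈-∃++ (∈-map⁺ (λ x → α x t) (Equivalence.from (∈-neighbours tree) e))
    ... | ps , qs , eq = Good⇒Small (Good-↭ (shift (α x t) ps qs) (subst Good eq (good t)))
    neighbour : ∀ t → ∃[ x ] T (adj t x)
    neighbour t with hasEdge
    ... | a , b , e with connected t a
    ...   | here = b , e
    ...   | step e′ _ = _ , e′

  -- Each element is placed at a home; the labels are then the components' parts, so norms become
  -- widths.
  LowTree⇒TreeDec : LowTree → ∃[ D ] (∀ t → nodeWidth M D t ℤ.< + k)
  LowTree⇒TreeDec L = D , λ t → Equivalence.from (nodeWidth<⇔Low D t) (subst Low (labels t) (low t))
    where
    open LowTree L
    homes : ∀ e → ∃ (TreeTheory.Home tree labelling e)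
    homes = TreeTheory.home tree labelling (proj₁ hasEdge)
    τ : Fin n → Fin nodes
    τ = proj₁ ∘ homes
    D : TreeDec n
    D = record { tree = tree ; τ = τ }
    labels : ∀ t → map (λ x → α x t) (neighbours tree t) ≡ map (λ x → component tree τ x t) (neighbours tree t)
    labels t = map-cong-local (All.tabulate (λ x∈ →
      TreeTheory.α≡component tree labelling τ (proj₂ ∘ homes) (Equivalence.to (∈-neighbours tree) x∈)))

  Conflict⇒LowTree : Conflict [] → LowTree
  Conflict⇒LowTree conflict with Conflict⇒GrownTree conflict
  ... | m , G , good , edge = record
        { tree = gtree G
        ; labelling = record
            { α = glabel G
            ; α-inv = glabel-inv G
            ; disjoint = λ {t} ex ey x≢y → AllPairs-lookup {R = λ x y → Disj (glabel G x t) (glabel G y t)} ⊆∁-sym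
                           (AllPairsₚ.map⁻ (proj₁ (good t)))
                           (Equivalence.from (gneighbours⇔gadj G) ex) (Equivalence.from (gneighbours⇔gadj G) ey) x≢y
            }
        ; low = λ t → proj₂ (Good-↭ (map⁺ _ (gneighbours↭neighbours G t)) (good t))
        ; hasEdge = edge
        }

  -- The implications of the circle.

  Tangle⇒HasTangle : ∀ {Q} → Tangle 0<k Q → HasTangle M k
  Tangle⇒HasTangle {Q} tangle =
    (_∈ Q) , (λ X X∈Q → Equivalence.from InSk⇔Small (proj₁ valid X∈Q))
           , (λ X sk → total (Equivalence.to InSk⇔Small sk) , λ X∈Q ∁X∈Q → contradiction ∁X∈Q (antisym X∈Q))
           , (λ a c _ _ a<c ∁a∈Q c∈Q →
               antisym (proj₂ valid c∈Q (proj₁ (proj₁ a<c)) (Small-∁⁻ (proj₁ valid ∁a∈Q))) ∁a∈Q)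
           , no-star′
    where
    open Tangle tangle
    no-star′ : ∀ σ → All (_∈ Q) σ → ¬ InF M k σ
    no-star′ [] _ (_ , ([]≢[] , _) , _) = []≢[] refl
    no-star′ (X ∷ σ) σ⊆Q inF@(u , _) = no-star u σ⊆Q (InF⇒Good inF)

  -- Self-inverse separations exist only over the empty ground set, where the star of `X` alone has
  -- norm 0 and is forbidden.
  HasTangle-proper : ((O , _) : HasTangle M k) → ∀ {X} → O X → X ≢ inv X
  HasTangle-proper (O , _ , _ , _ , no-star) {X} OX X≡∁X = no-star [ X ] (OX ∷ [])
    ([] ∷ [] , ((λ ()) , λ { _ _ (here refl) (here refl) a≢a → contradiction refl a≢a }) ,
     Equivalence.from (norm<⇔Low X []) low)
    where
    open ≤-Reasoning
    size0 : ∀ {n} (X : Subset n) → X ≡ ∁ X → ∣ ∁ X ∣ ≤ 0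
    size0 [] _ = z≤n
    size0 (inside ∷ _) ()
    size0 (outside ∷ _) ()
    low : r (∁ X) + 0 + R < k + (R + 0)
    low = begin-strict
      r (∁ X) + 0 + R  ≤⟨ +-monoˡ-≤ R (+-monoˡ-≤ 0 (≤-trans (r-bounded (∁ X)) (size0 X X≡∁X))) ⟩
      R                <⟨ m<n+m R 0<k ⟩
      k + R            ≡⟨ cong (λ j → k + j) (sym (+-identityʳ R)) ⟩
      k + (R + 0)      ∎

  -- Direct an edge from `t` to `x` when `α t x` is in `O`. A node with no outgoing edge would have
  -- its whole star inside `O`.
  HasTangle⇒¬SkTree : HasTangle M k → ¬ SkTree M k
  HasTangle⇒¬SkTree tangle@(O , O⊆Sk , total , _ , no-star) S =
    proj₂ (TreeTheory.sink tree (λ _ → ⊥) (λ t x → Σ (T (adj t x)) (O ∘ α t x))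
             (inj₂ ∘ next) no-return (proj₁ hasEdge))
    where
    open SkTree S
    open Tree tree
    split : ∀ {σ} → (∀ {s} → s ∈ σ → O s ⊎ O (inv s)) → All O σ ⊎ (∃[ s ] s ∈ σ × O (inv s))
    split {[]} _ = inj₁ []
    split {s ∷ σ} f with f (here refl) | split {σ} (f ∘ there)
    ... | inj₂ o | _ = inj₂ (s , here refl , o)
    ... | inj₁ _ | inj₂ (s′ , s′∈ , o) = inj₂ (s′ , there s′∈ , o)
    ... | inj₁ o | inj₁ os = inj₁ (o ∷ os)
    next : ∀ t → ∃[ x ] T (adj t x) × Σ (T (adj t x)) (O ∘ α t x)
    next t with α-star t
    ... | σ , inF , members with split {σ} (λ {s} s∈ → let (x , e , s≡) = Equivalence.to (members s) s∈ in
                                   proj₁ (total s (subst (InSk M k) s≡ (α-Sk x t e))))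
    ...   | inj₁ os = contradiction inF (no-star σ os)
    ...   | inj₂ (s , s∈ , o) with Equivalence.to (members s) s∈
    ...     | x , e , refl = x , e′ , e′ , subst O (sym (α-inv x t e e′)) o
      where
      e′ : T (adj t x)
      e′ = subst T (adj-sym x t) e
    no-return : ∀ {t x} → Σ (T (adj t x)) (O ∘ α t x) → ¬ Σ (T (adj x t)) (O ∘ α x t)
    no-return {t} {x} (e , o) (e′ , o′) = HasTangle-proper tangle o
      (proj₂ (total (α t x e) (α-Sk t x e)) o (subst O (α-inv t x e e′) o′))

  -- A decomposition without edges has width r(M), so r(M) < k. Then the stars of `∅` alone and of
  -- the ground set alone both have low norm and give a tree with one edge.
  narrow⇒SkTree : (D : TreeDec n) → (∀ t → nodeWidth M D t ℤ.< + k) → SkTree M k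
  narrow⇒SkTree D narrow with Finₚ.any? (λ x → Finₚ.any? (λ y → Boolₚ.T? (Tree.adj (TreeDec.tree D) x y)))
  ... | yes edge = LowTree⇒SkTree (record
          { tree = TreeDec.tree D
          ; labelling = TreeTheory.component-labelling (TreeDec.tree D) (TreeDec.τ D)
          ; low = λ t → Equivalence.to (nodeWidth<⇔Low D t) (narrow t)
          ; hasEdge = edge
          })
  ... | no no-edge = LowTree⇒SkTree (Conflict⇒LowTree (∅ , Br-∅ 0<k , node [] [] ([] ∷ [] , low)))
    where
    open Tree (TreeDec.tree D)
    node₀ : Fin nodes
    node₀ = fromℕ< nonempty
    R<k : R < k
    R<k with neighbours (TreeDec.tree D) node₀ in eq | Equivalence.to (nodeWidth<⇔Low D node₀) (narrow node₀)
    ... | [] | lt = subst (R <_) (+-identityʳ k) lt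
    ... | x ∷ _ | _ = contradiction (node₀ , x , Equivalence.to (∈-neighbours (TreeDec.tree D))
                                                   (subst (x ∈_) (sym eq) (here refl))) no-edge
    low : r (∁ (∁ (∁ ∅))) + 0 + R < k + (R + 0)
    low = begin-strict
      r (∁ (∁ (∁ ∅))) + 0 + R  ≡⟨ cong (_+ R) (+-identityʳ _) ⟩
      r (∁ (∁ (∁ ∅))) + R      ≤⟨ +-monoˡ-≤ R (r-mono (λ _ → ∈⊤)) ⟩
      R + R                    <⟨ +-monoˡ-< R R<k ⟩
      k + R                    ≡⟨ cong (λ j → k + j) (sym (+-identityʳ R)) ⟩
      k + (R + 0)              ∎
      where open ≤-Reasoning

  ¬SkTree⇒TreeWidth : ¬ SkTree M k → TreeWidthAtLeast M k
  ¬SkTree⇒TreeWidth ¬S D with Finₚ.any? (λ t → + k ℤₚ.≤? nodeWidth M D t)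
  ... | yes wide = wide
  ... | no none = contradiction (narrow⇒SkTree D (λ t → ℤₚ.≰⇒> (λ le → none (t , le)))) ¬S

  TreeWidth⇒HasTangle : TreeWidthAtLeast M k → HasTangle M k
  TreeWidth⇒HasTangle tw with duality 0<k
  ... | inj₁ (_ , tangle) = Tangle⇒HasTangle tangle
  ... | inj₂ conflict with LowTree⇒TreeDec (Conflict⇒LowTree conflict)
  ...   | D , narrow = let (t , le) = tw D in contradiction le (ℤₚ.<⇒≱ (narrow t))

theorem5p17 : ∀ {n : ℕ} (M : Matroid n) (k : ℕ) → 0 < k →
    (TreeWidthAtLeast M k ⇔ (¬ HasSkTree M k)) × ((¬ HasSkTree M k) ⇔ HasTangle M k)
theorem5p17 M k 0<k =
  mk⇔ (HasTangle⇒¬SkTree ∘ TreeWidth⇒HasTangle) ¬SkTree⇒TreeWidth ,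
  mk⇔ (TreeWidth⇒HasTangle ∘ ¬SkTree⇒TreeWidth) HasTangle⇒¬SkTree
  where open Main M k 0<k
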